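{- For every $n\ge1$, the fibers of the map $\rho:S_n\to\mathrm{dRec}_n$ are exactly the congruence classes of the congruence $\Theta_{\mathrm{tB}}$ on the weak order on $S_n$.
   Context: Permutations are written in one-line notation $x=x_1\cdots x_n\in S_n$. The (right) weak order on $S_n$ is the partial order in which one moves up by a cover by swapping two adjacent entries $x_i<x_{i+1}$ of $x$ (so that they occur out of numerical order); it is a lattice. The congruence $\Theta_{\mathrm{tB}}$. A permutation $x$ is obtained from $y$ by a $(3412\to3142)$-move if $y$ has a subsequence $c\,d\,a\,b$ with $a<b<c<d$ and $d$ immediately before $a$ in $y$, and $x$ is $y$ with $d$ and $a$ swapped. It is obtained from $y$ by a $(2413\to2143)$-move if $y$ has a subsequence $b\,d\,a\,c$ with $a<b<c<d$ and $d$ immediately before $a$ in $y$, and $x$ is $y$ with $d$ and $a$ swapped. $\Theta_{\mathrm{tB}}$ is the lattice congruence on the weak order on $S_n$ such that, for a cover $x\lessdot y$, one has $x\equiv y$ if and only if $x$ is obtained from $y$ by one of these two kinds of move. Its classes are intervals, so $\Theta_{\mathrm{tB}}$ is the equivalence relation generated by these moves (that this is a lattice congruence is a known result). Diagonal rectangulations. Let $S$ be a square with sides parallel to the coordinate axes; its diagonal is the interior of the segment from its top-left corner to its bottom-right corner. For a subdivision of $S$ into finitely many (axis-parallel) rectangles, the walls are the maximal line segments contained in the union of the boundaries of the rectangles, excluding the four edges of $S$. For a set $X$ of $n-1$ distinct points on the diagonal, a diagonal rectangulation of $(S,X)$ is a subdivision of $S$ into rectangles such that no two walls intersect in their interiors,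 every wall contains a point of $X$, and every point of $X$ lies on exactly one wall. Diagonal rectangulations are considered up to dilation or translation of $S$ and order-preserving motion of the points of $X$ along the diagonal (carrying the walls along); an equivalence class is a diagonal rectangulation of size $n$, and it has a unique integral representative, with $S=[0,n]\times[0,n]$ and $X=\{(i,n-i):1\le i\le n-1\}$. $\mathrm{dRec}_n$ is the set of diagonal rectangulations of size $n$, identified with their integral representatives. The map $\rho:S_n\to\mathrm{dRec}_n$. Let $S=[0,n]\times[0,n]$, $p_i=(i,n-i)$ for $0\le i\le n$, and give the space between $p_{k-1}$ and $p_k$ the label $k$. Read $x_1\cdots x_n$ from left to right, drawing one rectangle for each entry. Let $T_{i-1}$ be the union of the left and bottom edges of $S$ and the rectangles drawn in the first $i-1$ steps. In step $i$, put $k=x_i$, $p=p_{k-1}$, $p'=p_k$, and draw the rectangle with the following top-left and bottom-right corners. If $p\notin T_{i-1}$, the top-left corner is the rightmost point of $T_{i-1}$ directly left of $p$; if $p\in T_{i-1}$, it is the highest point of $T_{i-1}$ directly above (or equal to) $p$. If $p'\notin T_{i-1}$, the bottom-right corner is the highest point of $T_{i-1}$ directly below $p'$; if $p'\in T_{i-1}$, it is the rightmost point of $T_{i-1}$ directly right of (or equal to) $p'$. The $n$ rectangles drawn form the diagonal rectangulation $\rho(x)$. -}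

module Defs where

open import Data.Empty using (⊥-elim)
open import Data.Fin.Base as Fin using (Fin; toℕ; fromℕ<)
open import Data.Fin.Permutation using (Permutation′; _⟨$⟩ʳ_; _⟨$⟩ˡ_; _≈_; _∘ₚ_; transpose; inverseˡ; inverseʳ)
open import Data.Fin.Properties using (toℕ<n; toℕ-injective; toℕ-fromℕ<; fromℕ<-toℕ)
open import Data.List.Base using (List; []; _∷_)
open import Data.List.Membership.Propositional using (_∈_; find; lose)
open import Data.List.Relation.Binary.BagAndSetEquality using (_∼[_]_; set)
open import Data.List.Relation.Unary.All using (All)
import Data.List.Relation.Unary.All as All
open import Data.List.Relation.Unary.Any using (Any; any?; here; there)
open import Data.Nat.Base
open import Data.Nat.Properties
open import Data.Product.Base using (_×_; _,_; proj₁; proj₂; ∃; ∃-syntax; Σ-syntax)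
open import Data.Product using (∃!)
open import Data.Sum.Base using (_⊎_; inj₁; inj₂; [_,_]′)
open import Function.Base using (flip; _∘_)
open import Level using (0ℓ)
open import Relation.Binary.Construct.Closure.Equivalence using (EqClosure)
open import Relation.Binary.PropositionalEquality using (_≡_; _≢_; ≢-sym; refl; sym; trans; cong; subst)
open import Relation.Nullary using (¬_; Dec; yes; no; _×-dec_; _⊎-dec_)
open import Relation.Unary using (Pred; Decidable)

-- x = x₁⋯xₙ is encoded by x ⟨$⟩ʳ i = xᵢ, positions and entries both
-- being counted from 0.  Equality in Sₙ is the pointwise equality _≈_.
-- Composing with transpose i j on the left exchanges the entries in
-- positions i and j.

record Move₃₄₁₂→₃₁₄₂ {n} (x y : Permutation′ n) : Set where
  field
    pc pd pa pb : Fin n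
    pc<pd       : pc Fin.< pd
    pd⋖pa       : toℕ pa ≡ suc (toℕ pd)
    pa<pb       : pa Fin.< pb
    a<b         : y ⟨$⟩ʳ pa Fin.< y ⟨$⟩ʳ pb
    b<c         : y ⟨$⟩ʳ pb Fin.< y ⟨$⟩ʳ pc
    c<d         : y ⟨$⟩ʳ pc Fin.< y ⟨$⟩ʳ pd
    swapped     : x ≈ transpose pd pa ∘ₚ y

record Move₂₄₁₃→₂₁₄₃ {n} (x y : Permutation′ n) : Set where
  field
    pb pd pa pc : Fin n
    pb<pd       : pb Fin.< pd
    pd⋖pa       : toℕ pa ≡ suc (toℕ pd)
    pa<pc       : pa Fin.< pc
    a<b         : y ⟨$⟩ʳ pa Fin.< y ⟨$⟩ʳ pb
    b<c         : y ⟨$⟩ʳ pb Fin.< y ⟨$⟩ʳ pc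
    c<d         : y ⟨$⟩ʳ pc Fin.< y ⟨$⟩ʳ pd
    swapped     : x ≈ transpose pd pa ∘ₚ y

-- The congruence classes are intervals of the weak order, so Θ-tB is
-- generated as an equivalence relation by the covers that it
-- contracts.  The pointwise equality of permutations has to be added
-- because it is coarser than _≡_.

Θ-tB : ∀ {n} → Permutation′ n → Permutation′ n → Set
Θ-tB = EqClosure λ x y →
  x ≈ y ⊎ Move₃₄₁₂→₃₁₄₂ x y ⊎ Move₂₄₁₃→₂₁₄₃ x y

-- S = [0,n] × [0,n] and X = {(i , n ∸ i) : 1 ≤ i ≤ n-1}.  Every wall is
-- horizontal or vertical and contains a point of X, so all corners of
-- rectangles and all endpoints of walls are integral, and S may be
-- inspected one unit cell and one unit edge at a time.

record Rect : Set where
  constructor rect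
  field
    left right bottom top : ℕ

open Rect public

HasPoint : ℕ → ℕ → Rect → Set
HasPoint a b r = (left r ≤ a × a ≤ right r) × (bottom r ≤ b × b ≤ top r)

-- The cell [i,i+1] × [j,j+1] lies in r.
HasCell : ℕ → ℕ → Rect → Set
HasCell i j r = (left r ≤ i × i < right r) × (bottom r ≤ j × j < top r)

record IsSubdivision (n : ℕ) (R : List Rect) : Set where
  field
    proper   : All (λ r → (left r < right r × right r ≤ n) × (bottom r < top r × top r ≤ n)) R
    covers   : ∀ {i j} → i < n → j < n → Any (HasCell i j) R
    disjoint : ∀ {i j r s} → r ∈ R → s ∈ R → HasCell i j r → HasCell i j s → r ≡ s

-- The unit edge [i,i+1] × {y}, respectively {x} × [j,j+1], lies in the
-- union of the boundaries of the rectangles.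
HEdge : List Rect → (y i : ℕ) → Set
HEdge R y i = Any (λ r → (left r ≤ i × i < right r) × (y ≡ bottom r ⊎ y ≡ top r)) R

VEdge : List Rect → (x j : ℕ) → Set
VEdge R x j = Any (λ r → (bottom r ≤ j × j < top r) × (x ≡ left r ⊎ x ≡ right r)) R

data Segment : Set where
  horizontal : (a c y : ℕ) → Segment  -- [a,c] × {y}
  vertical   : (b d x : ℕ) → Segment  -- {x} × [b,d]

_∋[_,_] : Segment → ℕ → ℕ → Set
horizontal a c y ∋[ u , v ] = v ≡ y × a ≤ u × u ≤ c
vertical   b d x ∋[ u , v ] = u ≡ x × b ≤ v × v ≤ d

-- E i means that the unit edge [i,i+1] of a fixed line is present; then
-- [a,c] is a maximal segment made of such edges.
record MaximalRun (E : Pred ℕ 0ℓ) (a c : ℕ) : Set where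
  constructor run
  field
    nonempty : a < c
    within   : ∀ {i} → a ≤ i → i < c → E i
    maxˡ     : ∀ {i} → suc i ≡ a → ¬ E i
    maxʳ     : ¬ E c

-- The strict bounds on y and x exclude the edges of S.
IsWall : ℕ → List Rect → Segment → Set
IsWall n R (horizontal a c y) = (0 < y × y < n) × MaximalRun (HEdge R y) a c
IsWall n R (vertical   b d x) = (0 < x × x < n) × MaximalRun (VEdge R x) b d

-- Distinct parallel walls have disjoint interiors by maximality, and a
-- horizontal and a vertical wall can only meet in an integral point.

record IsDiagonal (n : ℕ) (R : List Rect) : Set where
  field
    subdivision  : IsSubdivision n R
    noncrossing  : ∀ {a c y b d x} → IsWall n R (horizontal a c y) → IsWall n R (vertical b d x) →
                   ¬ ((a < x × x < c) × (b < y × y < d))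
    wallHasPoint : ∀ w → IsWall n R w → ∃[ i ] (1 ≤ i × i < n × w ∋[ i , n ∸ i ])
    pointOnWall  : ∀ {i} → 1 ≤ i → i < n → ∃! _≡_ λ w → IsWall n R w × w ∋[ i , n ∸ i ]

-- Members of dRecₙ are represented by integral representatives.  The
-- order and multiplicity of the listed rectangles do not matter.
record DRec (n : ℕ) : Set where
  constructor dRec
  field
    rectangles : List Rect
    isDiagonal : IsDiagonal n rectangles

open DRec public

infix 4 _≈ᴿ_

_≈ᴿ_ : ∀ {n} → DRec n → DRec n → Set
D ≈ᴿ D′ = rectangles D ∼[ set ] rectangles D′

-- (a , b) ∈ T, for a point (a , b) of S, where T is the union of the
-- left and bottom edges of S and the rectangles in R.
InT : List Rect → ℕ → ℕ → Set
InT R a b = a ≡ 0 ⊎ b ≡ 0 ⊎ Any (HasPoint a b) R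

inT? : ∀ R a b → Dec (InT R a b)
inT? R a b = (a ≟ 0) ⊎-dec (b ≟ 0) ⊎-dec any? hasPoint? R
  where
  hasPoint? : Decidable (HasPoint a b)
  hasPoint? r = (left r ≤? a ×-dec a ≤? right r) ×-dec (bottom r ≤? b ×-dec b ≤? top r)

-- The largest a ≤ m satisfying P (or 0 if there is none).
largest : {P : Pred ℕ 0ℓ} → Decidable P → ℕ → ℕ
largest P? zero    = zero
largest P? (suc m) with P? (suc m)
... | yes _ = suc m
... | no  _ = largest P? m

-- The label with index k = 0, …, n-1 lies between the points
-- p = (k , n ∸ k) and p′ = (k + 1 , n ∸ (k + 1)).  As T is closed with
-- integral corners, its extremal points on the lines through p and p′
-- are integral.  If p ∈ T, the highest point of T on the vertical line
-- through p is at or above p; similarly for p′.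

topLeft : ℕ → List Rect → ℕ → ℕ × ℕ
topLeft n R k with inT? R k (n ∸ k)
... | no  _ = largest (λ a → inT? R a (n ∸ k)) k , n ∸ k
... | yes _ = k , largest (inT? R k) n

bottomRight : ℕ → List Rect → ℕ → ℕ × ℕ
bottomRight n R k with inT? R (suc k) (n ∸ suc k)
... | no  _ = suc k , largest (inT? R (suc k)) (n ∸ suc k)
... | yes _ = largest (λ a → inT? R a (n ∸ suc k)) n , n ∸ suc k

draw : ℕ → List Rect → ℕ → Rect
draw n R k = rect (proj₁ tl) (proj₁ br) (proj₂ br) (proj₂ tl)
  where
  tl = topLeft n R k
  br = bottomRight n R k

-- The rectangles drawn in the first t steps.
drawn : ∀ {n} → Permutation′ n → (t : ℕ) → t ≤ n → List Rect
drawn x zero    _   = []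
drawn {n} x (suc t) t<n = draw n R (toℕ (x ⟨$⟩ʳ fromℕ< t<n)) ∷ R
  where R = drawn x t (<⇒≤ t<n)

module WellDefined where

  largest≤ : {P : Pred ℕ 0ℓ} (P? : Decidable P) (m : ℕ) → largest P? m ≤ m
  largest≤ P? zero = z≤n
  largest≤ P? (suc m) with P? (suc m)
  ... | yes _ = ≤-refl
  ... | no  _ = m≤n⇒m≤1+n (largest≤ P? m)

  largest-sat : {P : Pred ℕ 0ℓ} (P? : Decidable P) (m : ℕ) → 0 < largest P? m → P (largest P? m)
  largest-sat P? (suc m) 0<v with P? (suc m)
  ... | yes p = p
  ... | no  _ = largest-sat P? m 0<v

  largest-max : {P : Pred ℕ 0ℓ} (P? : Decidable P) (m : ℕ) {a : ℕ} → largest P? m < a → a ≤ m → ¬ P a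
  largest-max P? zero v<a a≤0 _ = <⇒≱ v<a a≤0
  largest-max P? (suc m) v<a a≤m p with P? (suc m)
  ... | yes _ = <⇒≱ v<a a≤m
  ... | no ¬p with m≤n⇒m<n∨m≡n a≤m
  ...   | inj₁ (s≤s a≤m′) = largest-max P? m v<a a≤m′ p
  ...   | inj₂ refl       = ¬p p

  largest≥ : {P : Pred ℕ 0ℓ} (P? : Decidable P) (m : ℕ) {a : ℕ} → P a → a ≤ m → a ≤ largest P? m
  largest≥ P? m {a} p a≤m with a ≤? largest P? m
  ... | yes a≤v = a≤v
  ... | no  a≰v = ⊥-elim (largest-max P? m (≰⇒> a≰v) a≤m p)

  ∸∸ : ∀ {n m} → m ≤ n → n ∸ (n ∸ m) ≡ m
  ∸∸ = m∸[m∸n]≡n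

  ∸-< : ∀ {n a b} → a < b → b ≤ n → n ∸ b < n ∸ a
  ∸-< = ∸-monoʳ-<

  ∸-≤⁻ : ∀ {n a b} → a ≤ n → n ∸ b ≤ n ∸ a → a ≤ b
  ∸-≤⁻ = ∸-cancelʳ-≤

  ∸-<⁻ : ∀ {n a b} → n ∸ b < n ∸ a → a < b
  ∸-<⁻ {n} = ∸-cancelʳ-< {o = n}

  n∸1+m<n : ∀ {n m} → m < n → n ∸ suc m < n
  n∸1+m<n {n} {m} m<n = ≤-<-trans (∸-monoʳ-≤ n (s≤s z≤n)) (lemma m<n)
    where
    lemma : ∀ {n m} → m < n → n ∸ 1 < n
    lemma (s≤s _) = ≤-refl

  1+[n∸1+m] : ∀ {n m} → m < n → suc (n ∸ suc m) ≡ n ∸ m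
  1+[n∸1+m] {n} {m} m<n = sym (+-∸-assoc 1 m<n)

  row : ∀ {n j} → j < n → n ∸ suc (n ∸ suc j) ≡ j
  row {n} {j} j<n = trans (cong (n ∸_) (1+[n∸1+m] j<n)) (∸∸ (<⇒≤ j<n))

  module Run {E : Pred ℕ 0ℓ} where

    extendʳ : Decidable E → ∀ f {i n} → n ≤ i + f → (∀ {j} → E j → j < n) → E i →
              ∃[ c ] (i < c × (∀ {j} → i ≤ j → j < c → E j) × ¬ E c)
    extendʳ E? zero {i} {n} n≤ b e =
      ⊥-elim (<⇒≱ (b e) (subst (n ≤_) (+-identityʳ i) n≤))
    extendʳ E? (suc f) {i} {n} n≤ b e with E? (suc i)
    ... | no ¬e = suc i , ≤-refl , (λ i≤j j<1+i → subst E (≤-antisym i≤j (s≤s⁻¹ j<1+i)) e) , ¬e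
    ... | yes e′ with extendʳ E? f (subst (n ≤_) (+-suc i f) n≤) b e′
    ...   | c , i<c , w , ¬e = c , <⇒≤ i<c , w′ , ¬e
      where
      w′ : ∀ {j} → i ≤ j → j < c → E j
      w′ i≤j j<c with m≤n⇒m<n∨m≡n i≤j
      ... | inj₁ i<j  = w i<j j<c
      ... | inj₂ refl = e

    extendˡ : Decidable E → ∀ i → E i →
              ∃[ a ] (a ≤ i × (∀ {j} → a ≤ j → j ≤ i → E j) × (∀ {j} → suc j ≡ a → ¬ E j))
    extendˡ E? zero e = 0 , z≤n , (λ _ j≤0 → subst E (sym (n≤0⇒n≡0 j≤0)) e) , λ ()
    extendˡ E? (suc i) e with E? i
    ... | no ¬e = suc i , ≤-refl , (λ p q → subst E (≤-antisym p q) e) , λ { refl → ¬e }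
    ... | yes e′ with extendˡ E? i e′
    ...   | a , a≤i , w , m = a , m≤n⇒m≤1+n a≤i , w′ , m
      where
      w′ : ∀ {j} → a ≤ j → j ≤ suc i → E j
      w′ a≤j j≤ with m≤n⇒m<n∨m≡n j≤
      ... | inj₁ (s≤s j≤i) = w a≤j j≤i
      ... | inj₂ refl      = e

    exists : Decidable E → ∀ {i n} → (∀ {j} → E j → j < n) → E i →
             ∃[ a ] ∃[ c ] (a ≤ i × i < c × MaximalRun E a c)
    exists E? {i} {n} b e with extendˡ E? i e | extendʳ E? n (m≤n+m n i) b e
    ... | a , a≤i , w , m | c , i<c , w′ , m′ =
      a , c , a≤i , i<c , run (≤-<-trans a≤i i<c) within m m′
      where
      within : ∀ {j} → a ≤ j → j < c → E j
      within {j} a≤j j<c with j ≤? i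
      ... | yes j≤i = w a≤j j≤i
      ... | no  j≰i = w′ (<⇒≤ (≰⇒> j≰i)) j<c

    start≤ : ∀ {i a c a′ c′} → MaximalRun E a c → MaximalRun E a′ c′ →
             i < c → a′ ≤ i → a′ ≤ a
    start≤ {a = a} {a′ = a′} r r′ i<c a′≤i with a′ ≤? a
    ... | yes p = p
    start≤ {a′ = zero} r r′ i<c a′≤i | no ¬p = ⊥-elim (¬p z≤n)
    start≤ {a′ = suc a″} r r′ i<c a′≤i | no ¬p =
      ⊥-elim (MaximalRun.maxˡ r′ refl
        (MaximalRun.within r (s≤s⁻¹ (≰⇒> ¬p)) (<-trans a′≤i i<c)))

    end≤ : ∀ {i a c a′ c′} → MaximalRun E a c → MaximalRun E a′ c′ →
           a ≤ i → i < c′ → c ≤ c′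
    end≤ {c = c} {c′ = c′} r r′ a≤i i<c′ with c ≤? c′
    ... | yes p = p
    ... | no ¬p = ⊥-elim (MaximalRun.maxʳ r′
        (MaximalRun.within r (≤-trans a≤i (<⇒≤ i<c′)) (≰⇒> ¬p)))

    unique : ∀ {i a c a′ c′} → MaximalRun E a c → MaximalRun E a′ c′ →
             a ≤ i → i < c → a′ ≤ i → i < c′ → a ≡ a′ × c ≡ c′
    unique r r′ p q p′ q′ =
      ≤-antisym (start≤ r′ r q′ p) (start≤ r r′ q p′) ,
      ≤-antisym (end≤ r r′ p q′) (end≤ r′ r p′ q)

    -- A run of a predicate whose support is closed under moving towards h.
    towards : ∀ {h a c} → (∀ {i} → suc i < h → E i → E (suc i)) → (∀ {i} → h ≤ i → E (suc i) → E i) →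
              MaximalRun E a c → a ≤ h × h ≤ c
    towards {h} {a} {c} up down (run ne w mˡ mʳ) = lo ne w mˡ , hi ne w mʳ
      where
      lo : ∀ {a} → a < c → (∀ {i} → a ≤ i → i < c → E i) → (∀ {i} → suc i ≡ a → ¬ E i) → a ≤ h
      lo {zero} _ _ _ = z≤n
      lo {suc i} ne w m with suc i ≤? h
      ... | yes p = p
      ... | no ¬p = ⊥-elim (m refl (down (s≤s⁻¹ (≰⇒> ¬p)) (w ≤-refl ne)))
      hi : ∀ {c} → a < c → (∀ {i} → a ≤ i → i < c → E i) → ¬ E c → h ≤ c
      hi {suc i} (s≤s a≤i) w m with h ≤? suc i
      ... | yes p = p
      ... | no ¬p = ⊥-elim (m (up (≰⇒> ¬p) (w a≤i ≤-refl)))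

    -- A run touching g + 1 contains the unit edge at g.
    contains : ∀ {g a c} → E g → MaximalRun E a c → a ≤ suc g → suc g ≤ c → a ≤ g × g < c
    contains e r a≤1+g g<c with m≤n⇒m<n∨m≡n a≤1+g
    ... | inj₁ (s≤s a≤g) = a≤g , g<c
    ... | inj₂ refl      = ⊥-elim (MaximalRun.maxˡ r refl e)

  -- Combinatorics of a total order on labels.  The rectangle with label k
  -- contains the unit cell in column i and in row r, counted from the
  -- top, when k is the first label in {i,…,r} or the last one in {r,…,i}.

  First : (ℕ → ℕ → Set) → (k i r : ℕ) → Set
  First _≼_ k i r = i ≤ k × k ≤ r × (∀ {m} → i ≤ m → m ≤ r → k ≼ m)

  Owner : (ℕ → ℕ → Set) → (k i r : ℕ) → Set
  Owner _≼_ k i r = (i ≤ r × First _≼_ k i r) ⊎ (r ≤ i × First (flip _≼_) k r i)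

  swapOwner : ∀ {_≼_ k i r} → Owner _≼_ k i r → Owner (flip _≼_) k r i
  swapOwner (inj₁ p) = inj₂ p
  swapOwner (inj₂ p) = inj₁ p

  -- Unit edge in column i between the rows g and g + 1.
  Sep : (ℕ → ℕ → Set) → (i g : ℕ) → Set
  Sep _≼_ i g = ∃[ k ] ((Owner _≼_ k i g × ¬ Owner _≼_ k i (suc g))
                      ⊎ (¬ Owner _≼_ k i g × Owner _≼_ k i (suc g)))

  Sep′ : (ℕ → ℕ → Set) → (i g : ℕ) → Set
  Sep′ _≼_ i g = (i ≤ g × (∀ {m} → i ≤ m → m ≤ g → suc g ≼ m))
               ⊎ (g < i × (∀ {m} → g < m → m ≤ i → m ≼ g))

  -- The rectangle in columns l,…,r-1 and rows t,…,b-1 is the one that is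
  -- drawn for the label k when the preceding labels are already drawn.
  record Spec (n : ℕ) (_≼_ : ℕ → ℕ → Set) (k l r t b : ℕ) : Set where
    constructor spec
    field
      l≤k  : l ≤ k
      l-in : ∀ {m} → l ≤ m → m ≤ k → k ≼ m
      l-ex : ∀ {m} → suc m ≡ l → ¬ k ≼ m
      k<b  : k < b
      b≤n  : b ≤ n
      b-in : ∀ {m} → k ≤ m → m < b → k ≼ m
      b-ex : b < n → ¬ k ≼ b
      t≤k  : t ≤ k
      t-in : ∀ {m} → t ≤ m → m ≤ k → m ≼ k
      t-ex : ∀ {m} → suc m ≡ t → ¬ m ≼ k
      k<r  : k < r
      r≤n  : r ≤ n
      r-in : ∀ {m} → k ≤ m → m < r → m ≼ k
      r-ex : r < n → ¬ r ≼ k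

  flipSpec : ∀ {n _≼_ k l r t b} → Spec n _≼_ k l r t b → Spec n (flip _≼_) k t b l r
  flipSpec (spec a b c d e f g h i j k l m n) = spec h i j k l m n a b c d e f g

  module Labels (_≼_ : ℕ → ℕ → Set)
    (≼-refl : ∀ {k} → k ≼ k)
    (≼-trans : ∀ {k l m} → k ≼ l → l ≼ m → k ≼ m)
    (≼-antisym : ∀ {k l} → k ≼ l → l ≼ k → k ≡ l)
    (≼-total : ∀ k l → k ≼ l ⊎ l ≼ k)
    where

    asFirst : ∀ {k i r} → i ≤ r → Owner _≼_ k i r → First _≼_ k i r
    asFirst _ (inj₁ (_ , f)) = f
    asFirst {k} i≤r (inj₂ (r≤i , r≤k , k≤i , _)) with ≤-antisym i≤r r≤i
    ... | refl = r≤k , k≤i , λ p q → subst (k ≼_) (trans (≤-antisym k≤i r≤k) (≤-antisym p q)) ≼-refl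

    asLast : ∀ {k i r} → r ≤ i → Owner _≼_ k i r → First (flip _≼_) k r i
    asLast _ (inj₂ (_ , f)) = f
    asLast {k} r≤i (inj₁ (i≤r , i≤k , k≤r , _)) with ≤-antisym i≤r r≤i
    ... | refl = i≤k , k≤r , λ p q → subst (_≼ k) (trans (≤-antisym k≤r i≤k) (≤-antisym p q)) ≼-refl

    first : ∀ i d → ∃[ k ] First _≼_ k i (d + i)
    first i zero = i , ≤-refl , ≤-refl , λ p q → subst (i ≼_) (≤-antisym p q) ≼-refl
    first i (suc d) with first i d
    ... | k , i≤k , k≤ , f with ≼-total k (suc (d + i))
    ...   | inj₁ k≼ = k , i≤k , m≤n⇒m≤1+n k≤ , g
      where
      g : ∀ {m} → i ≤ m → m ≤ suc (d + i) → k ≼ m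
      g p q with m≤n⇒m<n∨m≡n q
      ... | inj₁ (s≤s q′) = f p q′
      ... | inj₂ refl     = k≼
    ...   | inj₂ ≼k = suc (d + i) , m≤n⇒m≤1+n (m≤n+m i d) , ≤-refl , g
      where
      g : ∀ {m} → i ≤ m → m ≤ suc (d + i) → suc (d + i) ≼ m
      g p q with m≤n⇒m<n∨m≡n q
      ... | inj₁ (s≤s q′) = ≼-trans ≼k (f p q′)
      ... | inj₂ refl     = ≼-refl

    firstOwner : ∀ {i r} → i ≤ r → ∃[ k ] Owner _≼_ k i r
    firstOwner {i} {r} i≤r with first i (r ∸ i)
    ... | k , f = k , inj₁ (i≤r , subst (First _≼_ k i) (m∸n+n≡m i≤r) f)

    ownerUnique : ∀ {k k′ i r} → Owner _≼_ k i r → Owner _≼_ k′ i r → k ≡ k′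
    ownerUnique (inj₁ (i≤r , p , q , f)) o with asFirst i≤r o
    ... | p′ , q′ , f′ = ≼-antisym (f p′ q′) (f′ p q)
    ownerUnique (inj₂ (r≤i , p , q , f)) o with asLast r≤i o
    ... | p′ , q′ , f′ = ≼-antisym (f′ p q) (f p′ q′)

    ownerBound : ∀ {k i r n} → i < n → r < n → Owner _≼_ k i r → k < n
    ownerBound _ r<n (inj₁ (_ , _ , k≤r , _)) = ≤-<-trans k≤r r<n
    ownerBound i<n _ (inj₂ (_ , _ , k≤i , _)) = ≤-<-trans k≤i i<n

    sep⇒ : ∀ {i g} → Sep _≼_ i g → Sep′ _≼_ i g
    sep⇒ {i} {g} s with i ≤? g
    sep⇒ {i} {g} (k , inj₁ (o , ¬o)) | yes i≤g with asFirst i≤g o | ≼-total k (suc g)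
    ... | i≤k , k≤g , f | inj₂ g≼k = inj₁ (i≤g , λ p q → ≼-trans g≼k (f p q))
    ... | i≤k , k≤g , f | inj₁ k≼g = ⊥-elim (¬o (inj₁ (m≤n⇒m≤1+n i≤g , i≤k , m≤n⇒m≤1+n k≤g , h)))
      where
      h : ∀ {m} → i ≤ m → m ≤ suc g → k ≼ m
      h p q with m≤n⇒m<n∨m≡n q
      ... | inj₁ (s≤s q′) = f p q′
      ... | inj₂ refl     = k≼g
    sep⇒ {i} {g} (k , inj₂ (¬o , o)) | yes i≤g with asFirst (m≤n⇒m≤1+n i≤g) o
    ... | i≤k , k≤1+g , f with m≤n⇒m<n∨m≡n k≤1+g
    ...   | inj₁ (s≤s k≤g) = ⊥-elim (¬o (inj₁ (i≤g , i≤k , k≤g , λ p q → f p (m≤n⇒m≤1+n q))))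
    ...   | inj₂ refl      = inj₁ (i≤g , λ p q → f p (m≤n⇒m≤1+n q))
    sep⇒ {i} {g} (k , inj₁ (o , ¬o)) | no i≰g with asLast (<⇒≤ (≰⇒> i≰g)) o
    ... | g≤k , k≤i , f with m≤n⇒m<n∨m≡n g≤k
    ...   | inj₁ g<k  = ⊥-elim (¬o (inj₂ (≰⇒> i≰g , g<k , k≤i , λ p q → f (<⇒≤ p) q)))
    ...   | inj₂ refl = inj₂ (≰⇒> i≰g , λ p q → f (<⇒≤ p) q)
    sep⇒ {i} {g} (k , inj₂ (¬o , o)) | no i≰g with asLast (≰⇒> i≰g) o | ≼-total g k
    ... | g<k , k≤i , f | inj₂ k≼g = inj₂ (≰⇒> i≰g , λ p q → ≼-trans (f p q) k≼g)
    ... | g<k , k≤i , f | inj₁ g≼k = ⊥-elim (¬o (inj₂ (<⇒≤ (≰⇒> i≰g) , <⇒≤ g<k , k≤i , h)))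
      where
      h : ∀ {m} → g ≤ m → m ≤ i → m ≼ k
      h p q with m≤n⇒m<n∨m≡n p
      ... | inj₁ p′   = f p′ q
      ... | inj₂ refl = g≼k

    sep⇐ : ∀ {i g} → Sep′ _≼_ i g → Sep _≼_ i g
    sep⇐ {i} {g} (inj₁ (i≤g , f)) = suc g , inj₂ (¬o , inj₁ (m≤n⇒m≤1+n i≤g , m≤n⇒m≤1+n i≤g , ≤-refl , h))
      where
      ¬o : ¬ Owner _≼_ (suc g) i g
      ¬o o with asFirst i≤g o
      ... | _ , 1+g≤g , _ = <-irrefl refl 1+g≤g
      h : ∀ {m} → i ≤ m → m ≤ suc g → suc g ≼ m
      h p q with m≤n⇒m<n∨m≡n q
      ... | inj₁ (s≤s q′) = f p q′
      ... | inj₂ refl     = ≼-refl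
    sep⇐ {i} {g} (inj₂ (g<i , f)) = g , inj₁ (inj₂ (<⇒≤ g<i , ≤-refl , <⇒≤ g<i , h) , ¬o)
      where
      ¬o : ¬ Owner _≼_ g i (suc g)
      ¬o o with asLast g<i o
      ... | 1+g≤g , _ = <-irrefl refl 1+g≤g
      h : ∀ {m} → g ≤ m → m ≤ i → m ≼ g
      h p q with m≤n⇒m<n∨m≡n p
      ... | inj₁ p′   = f p′ q
      ... | inj₂ refl = ≼-refl

    sep-up : ∀ {i g} → suc i ≤ g → Sep _≼_ i g → Sep _≼_ (suc i) g
    sep-up i<g s with sep⇒ s
    ... | inj₁ (_ , f)   = sep⇐ (inj₁ (i<g , λ p q → f (<⇒≤ p) q))
    ... | inj₂ (g<i , _) = ⊥-elim (<-asym i<g g<i)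

    sep-down : ∀ {i g} → suc g ≤ i → Sep _≼_ (suc i) g → Sep _≼_ i g
    sep-down g<i s with sep⇒ s
    ... | inj₁ (i<g , _) = ⊥-elim (<-asym i<g g<i)
    ... | inj₂ (_ , f)   = sep⇐ (inj₂ (g<i , λ p q → f p (m≤n⇒m≤1+n q)))

    sep-dir : ∀ {i g} → Sep _≼_ i g → suc g ≼ g
    sep-dir s with sep⇒ s
    ... | inj₁ (i≤g , f) = f i≤g ≤-refl
    ... | inj₂ (g<i , f) = f ≤-refl g<i

    sep-left : ∀ {g} → suc g ≼ g → Sep _≼_ g g
    sep-left {g} 1+g≼g = sep⇐ (inj₁ (≤-refl , λ p q → subst (suc g ≼_) (≤-antisym p q) 1+g≼g))

    sep-right : ∀ {g} → suc g ≼ g → Sep _≼_ (suc g) g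
    sep-right {g} 1+g≼g = sep⇐ (inj₂ (≤-refl , λ p q → subst (_≼ g) (≤-antisym p q) 1+g≼g))

    module _ {n k l r t b} (S : Spec n _≼_ k l r t b) where
      open Spec S

      ¬¬≼ : ∀ {i j} → ¬ i ≼ j → j ≼ i
      ¬¬≼ {i} {j} ¬p with ≼-total i j
      ... | inj₁ p = ⊥-elim (¬p p)
      ... | inj₂ p = p

      owner⇐ : ∀ {i j} → i ≤ j → i < n → j < n → Owner _≼_ k i j →
               (l ≤ i × i < r) × (t ≤ j × j < b)
      owner⇐ {i} {j} i≤j i<n j<n o with asFirst i≤j o
      ... | i≤k , k≤j , f = (l≤i l-ex l≤k , ≤-<-trans i≤k k<r) , (≤-trans t≤k k≤j , j<b)
        where
        l≤i : ∀ {l} → (∀ {m} → suc m ≡ l → ¬ k ≼ m) → l ≤ k → l ≤ i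
        l≤i {zero} _ _ = z≤n
        l≤i {suc m} ex m<k with suc m ≤? i
        ... | yes p = p
        ... | no ¬p = ⊥-elim (ex refl (f (s≤s⁻¹ (≰⇒> ¬p)) (<⇒≤ (<-≤-trans m<k k≤j))))
        j<b : j < b
        j<b with suc j ≤? b
        ... | yes p = p
        ... | no ¬p = ⊥-elim (b-ex (≤-<-trans b≤j j<n) (f (≤-trans i≤k (<⇒≤ k<b)) b≤j))
          where b≤j = s≤s⁻¹ (≰⇒> ¬p)

      owner⇒ : ∀ {i j} → i ≤ j → (l ≤ i × i < r) × (t ≤ j × j < b) → Owner _≼_ k i j
      owner⇒ {i} {j} i≤j ((l≤i , i<r) , (t≤j , j<b)) = inj₁ (i≤j , i≤k , k≤j , f)
        where
        i≤k : i ≤ k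
        i≤k with i ≤? k
        ... | yes p = p
        ... | no ¬p = ≤-reflexive (≼-antisym
                        (r-in (<⇒≤ k<i) i<r) (b-in (<⇒≤ k<i) (≤-<-trans i≤j j<b)))
          where k<i = ≰⇒> ¬p
        k≤j : k ≤ j
        k≤j with k ≤? j
        ... | yes p = p
        ... | no ¬p = ≤-reflexive (≼-antisym
                        (l-in (≤-trans l≤i i≤j) (<⇒≤ j<k)) (t-in t≤j (<⇒≤ j<k)))
          where j<k = ≰⇒> ¬p
        f : ∀ {m} → i ≤ m → m ≤ j → k ≼ m
        f {m} p q with m ≤? k
        ... | yes m≤k = l-in (≤-trans l≤i p) m≤k
        ... | no  m≰k = b-in (<⇒≤ (≰⇒> m≰k)) (≤-<-trans q j<b)

    specUnique : ∀ {n k l r t b l′ r′ t′ b′} → Spec n _≼_ k l r t b → Spec n _≼_ k l′ r′ t′ b′ →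
                 l ≡ l′ × b ≡ b′
    specUnique S S′ = ≤-antisym (lle S S′) (lle S′ S) , ≤-antisym (ble S S′) (ble S′ S)
      where
      open Spec
      lle : ∀ {n k l r t b l′ r′ t′ b′} → Spec n _≼_ k l r t b → Spec n _≼_ k l′ r′ t′ b′ → l ≤ l′
      lle {l = zero} S S′ = z≤n
      lle {l = suc m} {l′ = l′} S S′ with suc m ≤? l′
      ... | yes p = p
      ... | no ¬p = ⊥-elim (l-ex S refl (l-in S′ (s≤s⁻¹ (≰⇒> ¬p)) (<⇒≤ (l≤k S))))
      ble : ∀ {n k l r t b l′ r′ t′ b′} → Spec n _≼_ k l r t b → Spec n _≼_ k l′ r′ t′ b′ → b ≤ b′
      ble {b = b} {b′ = b′} S S′ with b ≤? b′
      ... | yes p = p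
      ... | no ¬p = ⊥-elim (b-ex S′ (<-≤-trans (≰⇒> ¬p) (b≤n S)) (b-in S (<⇒≤ (k<b S′)) (≰⇒> ¬p)))

  module Drawing {n : ℕ} (x : Permutation′ n) where

    -- The position of a label, extended by the identity outside of {0,…,n-1}.
    pos : ℕ → ℕ
    pos k with k <? n
    ... | yes k<n = toℕ (x ⟨$⟩ˡ fromℕ< k<n)
    ... | no  _   = k

    pos-fin : ∀ (k : Fin n) → pos (toℕ k) ≡ toℕ (x ⟨$⟩ˡ k)
    pos-fin k with toℕ k <? n
    ... | yes k<n = cong (λ j → toℕ (x ⟨$⟩ˡ j)) (fromℕ<-toℕ k k<n)
    ... | no  k≮n = ⊥-elim (k≮n (toℕ<n k))

    pos< : ∀ {k} → k < n → pos k < n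
    pos< {k} k<n with k <? n
    ... | yes _   = toℕ<n _
    ... | no  k≮n = ⊥-elim (k≮n k<n)

    entry : ∀ {t} → t < n → ℕ
    entry t<n = toℕ (x ⟨$⟩ʳ fromℕ< t<n)

    pos-entry : ∀ {t} (t<n : t < n) → pos (entry t<n) ≡ t
    pos-entry t<n = trans (pos-fin _) (trans (cong toℕ (inverseˡ x)) (toℕ-fromℕ< t<n))

    pos-injective : ∀ {k m} → pos k ≡ pos m → k ≡ m
    pos-injective {k} {m} eq with k <? n | m <? n
    ... | yes k<n | yes m<n =
      trans (sym (toℕ-fromℕ< k<n)) (trans (cong toℕ eq′) (toℕ-fromℕ< m<n))
      where
      eq′ : fromℕ< k<n ≡ fromℕ< m<n
      eq′ = trans (sym (inverseʳ x)) (trans (cong (x ⟨$⟩ʳ_) (toℕ-injective eq)) (inverseʳ x))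
    ... | yes _   | no  m≮n = ⊥-elim (m≮n (subst (_< n) eq (toℕ<n _)))
    ... | no  k≮n | yes _   = ⊥-elim (k≮n (subst (_< n) (sym eq) (toℕ<n _)))
    ... | no  _   | no  _   = eq

    infix 4 _≼_

    _≼_ : ℕ → ℕ → Set
    k ≼ m = pos k ≤ pos m

    module H = Labels _≼_ ≤-refl ≤-trans
      (λ p q → pos-injective (≤-antisym p q)) (λ k m → ≤-total (pos k) (pos m))
    module V = Labels (flip _≼_) ≤-refl (flip ≤-trans)
      (λ p q → pos-injective (≤-antisym q p)) (λ k m → ≤-total (pos m) (pos k))

    ≼k⇒< : ∀ {m k} → m ≼ k → m ≢ k → pos m < pos k
    ≼k⇒< p m≢k = ≤∧≢⇒< p (m≢k ∘ pos-injective)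

    IsRect : ℕ → Rect → Set
    IsRect k r = ∃[ a ] ∃[ c ] ∃[ t ] ∃[ b ] (Spec n _≼_ k a c t b × r ≡ rect a c (n ∸ b) (n ∸ t))

    record Inv (t : ℕ) (R : List Rect) : Set where
      field
        sound    : ∀ {r} → r ∈ R → ∃[ k ] (k < n × pos k < t × IsRect k r)
        complete : ∀ {k} → k < n → pos k < t → ∃[ r ] (r ∈ R × IsRect k r)

    cols-rows : ∀ {k a c t b i q} → Spec n _≼_ k a c t b → i < n → q < n → Owner _≼_ k i q →
                (a ≤ i × i < c) × (t ≤ q × q < b)
    cols-rows {k} S i<n q<n o@(inj₁ (i≤q , _)) = H.owner⇐ S i≤q i<n q<n o
    cols-rows {k} S i<n q<n o@(inj₂ (q≤i , _))
      with V.owner⇐ (flipSpec {_≼_ = _≼_} S) q≤i q<n i<n (swapOwner {_≼_ = _≼_} o)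
    ... | p , q = q , p

    cell⇐ : ∀ {k r i q} → IsRect k r → i < n → q < n → Owner _≼_ k i q → HasCell i (n ∸ suc q) r
    cell⇐ (a , c , t , b , S , refl) i<n q<n o with cols-rows S i<n q<n o
    ... | p , t≤q , q<b = p , ∸-monoʳ-≤ n q<b , ∸-< (s≤s t≤q) q<n

    rows : ∀ {t b q} → q < n → n ∸ b ≤ n ∸ suc q → n ∸ suc q < n ∸ t → t ≤ q × q < b
    rows q<n p p′ = s≤s⁻¹ (∸-<⁻ {n} p′) , ∸-≤⁻ q<n p

    cell⇒ : ∀ {k r i q} → IsRect k r → q < n → HasCell i (n ∸ suc q) r → Owner _≼_ k i q
    cell⇒ {i = i} {q} (a , c , t , b , S , refl) q<n (p , u , v) with ≤-total i q
    ... | inj₁ i≤q = H.owner⇒ S i≤q (p , rows q<n u v)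
    ... | inj₂ q≤i = swapOwner {_≼_ = flip _≼_}
                       (V.owner⇒ (flipSpec {_≼_ = _≼_} S) q≤i (rows q<n u v , p))

    isRect-unique : ∀ {k r s} → IsRect k r → IsRect k s → r ≡ s
    isRect-unique (a , c , t , b , S , refl) (a′ , c′ , t′ , b′ , S′ , refl)
      with H.specUnique S S′ | V.specUnique (flipSpec {_≼_ = _≼_} S) (flipSpec {_≼_ = _≼_} S′)
    ... | refl , refl | refl , refl = refl

    module Membership {t R} (inv : Inv t R) where
      open Inv inv

      member⇐ : ∀ {k i q} → i < n → q < n → Owner _≼_ k i q → pos k < t → InT R (suc i) (n ∸ q)
      member⇐ i<n q<n o k-used with complete (H.ownerBound i<n q<n o) k-used
      ... | _ , r∈R , (a , c , t , b , S , refl) with cols-rows S i<n q<n o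
      ...   | (a≤i , i<c) , t≤q , q<b = inj₂ (inj₂ (lose r∈R
                ((m≤n⇒m≤1+n a≤i , i<c) , ∸-monoʳ-≤ n (<⇒≤ q<b) , ∸-monoʳ-≤ n t≤q)))

      below⇐ : ∀ {i m q} → q < n → i ≤ m → m ≤ q → pos m < t → InT R (suc i) (n ∸ q)
      below⇐ q<n i≤m m≤q m-used with H.firstOwner (≤-trans i≤m m≤q)
      ... | k , o with H.asFirst (≤-trans i≤m m≤q) o
      ...   | _ , _ , f =
        member⇐ (≤-<-trans (≤-trans i≤m m≤q) q<n) q<n o (≤-<-trans (f i≤m m≤q) m-used)

      above⇐ : ∀ {i q} → i < n → q ≤ i → (∀ {m} → q ≤ m → m ≤ i → pos m < t) → InT R (suc i) (n ∸ q)
      above⇐ i<n q≤i used with V.firstOwner q≤i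
      ... | k , o with V.asFirst q≤i o
      ...   | q≤k , k≤i , _ =
        member⇐ i<n (≤-<-trans q≤i i<n) (swapOwner {_≼_ = flip _≼_} o) (used q≤k k≤i)

      member⇒ : ∀ {i q} → q < n → InT R (suc i) (n ∸ q) →
                ∃[ k ] (pos k < t × (∀ {m} → q ≤ m → m ≤ k → m ≼ k) × (∀ {m} → k ≤ m → m ≤ i → m ≼ k))
      member⇒ q<n (inj₂ (inj₁ eq)) = ⊥-elim (m>n⇒m∸n≢0 q<n eq)
      member⇒ q<n (inj₂ (inj₂ any)) with find any
      ... | r , r∈R , p with sound r∈R
      member⇒ q<n (inj₂ (inj₂ any)) | _ , r∈R , ((_ , i<c) , (_ , y≤))
          | k , k<n , k-used , (a , c , t , b , S , refl) =
            k , k-used , (λ p → t-in (≤-trans t≤q p)) , (λ p q → r-in p (≤-<-trans q i<c))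
        where
        open Spec S
        t≤q = ∸-≤⁻ (≤-trans t≤k (<⇒≤ k<n)) y≤

      below⇒ : ∀ {i q} → q < n → i ≤ q → InT R (suc i) (n ∸ q) → ∃[ m ] (i ≤ m × m ≤ q × pos m < t)
      below⇒ {i} {q} q<n i≤q p with member⇒ q<n p
      ... | k , k-used , f , g with i ≤? k | k ≤? q
      ...   | yes i≤k | yes k≤q = k , i≤k , k≤q , k-used
      ...   | no  i≰k | _       = i , ≤-refl , i≤q , ≤-<-trans (g (<⇒≤ (≰⇒> i≰k)) ≤-refl) k-used
      ...   | _       | no  k≰q = q , i≤q , ≤-refl , ≤-<-trans (f ≤-refl (<⇒≤ (≰⇒> k≰q))) k-used

      above⇒ : ∀ {i q} → q < n → InT R (suc i) (n ∸ q) → ∀ {m} → q ≤ m → m ≤ i → pos m < t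
      above⇒ q<n p {m} q≤m m≤i with member⇒ q<n p
      ... | k , k-used , f , g with m ≤? k
      ...   | yes m≤k = ≤-<-trans (f q≤m m≤k) k-used
      ...   | no  m≰k = ≤-<-trans (g (<⇒≤ (≰⇒> m≰k)) m≤i) k-used

    module Step {k R} (k<n : k < n) (inv : Inv (pos k) R) where
      open Membership inv

      only : ∀ {m} → k ≤ m → m < suc k → m ≡ k
      only p q = ≤-antisym (s≤s⁻¹ q) p

      pred-of : ∀ {m k} → m < k → ∃[ j ] (k ≡ suc j × m ≤ j)
      pred-of (s≤s m≤j) = _ , refl , m≤j

      TopLeft : ℕ × ℕ → Set
      TopLeft p = ∃[ l ] ∃[ t ] (p ≡ (l , n ∸ t) × l ≤ k
        × (∀ {m} → l ≤ m → m ≤ k → k ≼ m) × (∀ {m} → suc m ≡ l → ¬ k ≼ m) × t ≤ k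
        × (∀ {m} → t ≤ m → m ≤ k → m ≼ k) × (∀ {m} → suc m ≡ t → ¬ m ≼ k))

      topLeft-spec : TopLeft (topLeft n R k)
      topLeft-spec with inT? R k (n ∸ k)
      ... | no p∉T = l , k , refl , largest≤ P? k , l-in , l-ex , ≤-refl ,
                     (λ p q → ≤-reflexive (cong pos (≤-antisym q p))) , t-ex
        where
        P? = λ a → inT? R a (n ∸ k)
        l  = largest P? k
        l-in : ∀ {m} → l ≤ m → m ≤ k → k ≼ m
        l-in p q with m≤n⇒m<n∨m≡n q
        ... | inj₂ refl = ≤-refl
        ... | inj₁ m<k  = ≮⇒≥ λ used → largest-max P? k (s≤s p) m<k (below⇐ k<n ≤-refl (<⇒≤ m<k) used)
        l-ex : ∀ {m} → suc m ≡ l → ¬ k ≼ m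
        l-ex {m} eq k≼m with below⇒ k<n (≤-trans (n≤1+n m) m<k) (subst (λ a → InT R a (n ∸ k)) (sym eq)
                               (largest-sat P? k (subst (0 <_) eq z<s)))
          where m<k = subst (_≤ k) (sym eq) (largest≤ P? k)
        ... | m′ , m≤m′ , m′≤k , used with m≤n⇒m<n∨m≡n m≤m′
        ...   | inj₁ m<m′ = <⇒≱ used (l-in (subst (_≤ m′) eq m<m′) m′≤k)
        ...   | inj₂ refl = <⇒≱ used k≼m
        t-ex : ∀ {m} → suc m ≡ k → ¬ m ≼ k
        t-ex {m} refl m≼k = p∉T (below⇐ k<n ≤-refl (n≤1+n m) (≼k⇒< m≼k (λ ())))
      ... | yes p∈T = k , n ∸ v , cong (k ,_) (sym (∸∸ v≤n)) , ≤-refl ,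
                      (λ p q → ≤-reflexive (cong pos (≤-antisym p q))) , l-ex , t≤k , t-in , t-ex
        where
        P?  = inT? R k
        v   = largest P? n
        v≤n = largest≤ P? n
        v≥  : n ∸ k ≤ v
        v≥  = largest≥ P? n p∈T (m∸n≤m n k)
        t≤k : n ∸ v ≤ k
        t≤k = subst (n ∸ v ≤_) (∸∸ (<⇒≤ k<n)) (∸-monoʳ-≤ n v≥)
        l-ex : ∀ {m} → suc m ≡ k → ¬ k ≼ m
        l-ex {m} refl k≼m with below⇒ k<n (n≤1+n m) p∈T
        ... | m′ , m≤m′ , m′≤k , used with m≤n⇒m<n∨m≡n m≤m′
        ...   | inj₁ m<m′ = <-irrefl (cong pos (≤-antisym m′≤k m<m′)) used
        ...   | inj₂ refl = <⇒≱ used k≼m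
        t-in : ∀ {m} → n ∸ v ≤ m → m ≤ k → m ≼ k
        t-in {m} p q with m≤n⇒m<n∨m≡n q
        ... | inj₂ refl = ≤-refl
        ... | inj₁ m<k with pred-of m<k
        ...   | j , eq , m≤j = <⇒≤ (above⇒ (≤-<-trans t≤k k<n) sat p m≤j)
          where
          sat : InT R (suc j) (n ∸ (n ∸ v))
          sat = subst (λ a → InT R a (n ∸ (n ∸ v))) eq (subst (InT R k) (sym (∸∸ v≤n))
                  (largest-sat P? n (<-≤-trans (m<n⇒0<n∸m k<n) v≥)))
        t-ex : ∀ {m} → suc m ≡ n ∸ v → ¬ m ≼ k
        t-ex {m} eq m≼k with subst (_≤ k) (sym eq) t≤k
        ... | m<k with pred-of m<k
        ...   | j , refl , m≤j = largest-max P? n v< (m∸n≤m n m) (above⇐ (<⇒≤ k<n) m≤j used)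
          where
          v< : v < n ∸ m
          v< = subst (_< n ∸ m) (trans (cong (n ∸_) eq) (∸∸ v≤n)) (∸-< ≤-refl (<⇒≤ (≤-<-trans m<k k<n)))
          used : ∀ {m′} → m ≤ m′ → m′ ≤ j → pos m′ < pos (suc j)
          used {m′} p q with m≤n⇒m<n∨m≡n p
          ... | inj₁ m<m′ = ≼k⇒< (t-in (subst (_≤ m′) eq m<m′) (m≤n⇒m≤1+n q)) (<⇒≢ (s≤s q))
          ... | inj₂ refl = ≼k⇒< m≼k (<⇒≢ (s≤s q))

      BottomRight : ℕ × ℕ → Set
      BottomRight p = ∃[ r ] ∃[ b ] (p ≡ (r , n ∸ b) × k < b × b ≤ n
        × (∀ {m} → k ≤ m → m < b → k ≼ m) × (b < n → ¬ k ≼ b) × k < r × r ≤ n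
        × (∀ {m} → k ≤ m → m < r → m ≼ k) × (r < n → ¬ r ≼ k))

      bottomRight-spec : BottomRight (bottomRight n R k)
      bottomRight-spec with inT? R (suc k) (n ∸ suc k)
      ... | no p∉T = suc k , n ∸ v , cong (suc k ,_) (sym (∸∸ v≤n)) , k<b , m∸n≤m n v , b-in , b-ex ,
                     ≤-refl , k<n , (λ p q → ≤-reflexive (cong pos (only p q))) , r-ex
        where
        P?  = inT? R (suc k)
        v   = largest P? (n ∸ suc k)
        v≤  = largest≤ P? (n ∸ suc k)
        v≤n : v ≤ n
        v≤n = ≤-trans v≤ (m∸n≤m n (suc k))
        k<b : k < n ∸ v
        k<b = subst (_≤ n ∸ v) (∸∸ k<n) (∸-monoʳ-≤ n v≤)
        b-in : ∀ {m} → k ≤ m → m < n ∸ v → k ≼ m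
        b-in {m} p q with m≤n⇒m<n∨m≡n p
        ... | inj₂ refl = ≤-refl
        ... | inj₁ k<m  = ≮⇒≥ λ used → largest-max P? (n ∸ suc k)
                            (subst (_< n ∸ m) (∸∸ v≤n) (∸-< q (m∸n≤m n v))) (∸-monoʳ-≤ n k<m)
                            (below⇐ (<-≤-trans q (m∸n≤m n v)) p ≤-refl used)
        b-ex : n ∸ v < n → ¬ k ≼ n ∸ v
        b-ex b<n k≼b with below⇒ b<n (<⇒≤ k<b) (subst (InT R (suc k)) (sym (∸∸ v≤n))
                            (largest-sat P? (n ∸ suc k) (∸-<⁻ {n} b<n)))
        ... | m , k≤m , m≤b , used with m≤n⇒m<n∨m≡n m≤b
        ...   | inj₁ m<b  = <⇒≱ used (b-in k≤m m<b)
        ...   | inj₂ refl = <⇒≱ used k≼b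
        r-ex : suc k < n → ¬ suc k ≼ k
        r-ex r<n r≼k = p∉T (below⇐ r<n (n≤1+n k) ≤-refl (≼k⇒< r≼k 1+n≢n))
      ... | yes p∈T = v , suc k , refl , ≤-refl , k<n , (λ p q → ≤-reflexive (cong pos (sym (only p q)))) ,
                      b-ex , v≥ , v≤n , r-in , r-ex
        where
        P?  = λ a → inT? R a (n ∸ suc k)
        v   = largest P? n
        v≤n = largest≤ P? n
        v≥  : suc k ≤ v
        v≥  = largest≥ P? n p∈T k<n
        b-ex : suc k < n → ¬ k ≼ suc k
        b-ex b<n k≼b with below⇒ b<n (n≤1+n k) p∈T
        ... | m , k≤m , m≤b , used with m≤n⇒m<n∨m≡n m≤b
        ...   | inj₁ m<b  = <-irrefl (cong pos (only k≤m m<b)) used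
        ...   | inj₂ refl = <⇒≱ used k≼b
        r-in : ∀ {m} → k ≤ m → m < v → m ≼ k
        r-in {m} p q with m≤n⇒m<n∨m≡n p
        ... | inj₂ refl = ≤-refl
        ... | inj₁ k<m with pred-of q
        ...   | j , eq , m≤j = <⇒≤ (above⇒ (≤-<-trans k<m (<-≤-trans q v≤n)) sat k<m m≤j)
          where
          sat : InT R (suc j) (n ∸ suc k)
          sat = subst (λ a → InT R a (n ∸ suc k)) eq (largest-sat P? n (≤-trans z<s v≥))
        r-ex : v < n → ¬ v ≼ k
        r-ex v<n v≼k = largest-max P? n ≤-refl v<n (above⇐ v<n v≥ used)
          where
          used : ∀ {m} → suc k ≤ m → m ≤ v → pos m < pos k
          used p q with m≤n⇒m<n∨m≡n q
          ... | inj₁ m<v  = ≼k⇒< (r-in (<⇒≤ p) m<v) (≢-sym (<⇒≢ p))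
          ... | inj₂ refl = ≼k⇒< v≼k (≢-sym (<⇒≢ p))

      isRect : IsRect k (draw n R k)
      isRect with topLeft n R k | topLeft-spec | bottomRight n R k | bottomRight-spec
      ... | _ | l , t , refl , p₁ , p₂ , p₃ , p₄ , p₅ , p₆
          | _ | r , b , refl , q₁ , q₂ , q₃ , q₄ , q₅ , q₆ , q₇ , q₈ =
            l , r , t , b , spec p₁ p₂ p₃ q₁ q₂ q₃ q₄ p₄ p₅ p₆ q₅ q₆ q₇ q₈ , refl

    step : ∀ {k t R} → pos k ≡ t → k < n → Inv t R → Inv (suc t) (draw n R k ∷ R)
    step {k} {R = R} refl k<n inv = record { sound = sound′ ; complete = complete′ }
      where
      open Inv inv
      sound′ : ∀ {r} → r ∈ draw n R k ∷ R → ∃[ m ] (m < n × pos m < suc (pos k) × IsRect m r)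
      sound′ (here refl) = k , k<n , ≤-refl , Step.isRect k<n inv
      sound′ (there r∈R) with sound r∈R
      ... | m , m<n , used , isRect = m , m<n , m≤n⇒m≤1+n used , isRect
      complete′ : ∀ {m} → m < n → pos m < suc (pos k) → ∃[ r ] (r ∈ draw n R k ∷ R × IsRect m r)
      complete′ {m} m<n (s≤s m≼k) with m ≟ k
      ... | yes refl = _ , here refl , Step.isRect k<n inv
      ... | no  m≢k with complete m<n (≼k⇒< m≼k m≢k)
      ...   | r , r∈R , isRect = r , there r∈R , isRect

    inv : ∀ t (t≤n : t ≤ n) → Inv t (drawn x t t≤n)
    inv zero    _   = record { sound = λ () ; complete = λ _ () }
    inv (suc t) t<n = step (pos-entry t<n) (toℕ<n _) (inv t (<⇒≤ t<n))

    R : List Rect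
    R = drawn x n ≤-refl

    sound : ∀ {r} → r ∈ R → ∃[ k ] (k < n × IsRect k r)
    sound r∈R with Inv.sound (inv n ≤-refl) r∈R
    ... | k , k<n , _ , isRect = k , k<n , isRect

    complete : ∀ {k} → k < n → ∃[ r ] (r ∈ R × IsRect k r)
    complete k<n = Inv.complete (inv n ≤-refl) k<n (pos< k<n)

    own : ∀ {k a c t b i q} → Spec n _≼_ k a c t b → (a ≤ i × i < c) × (t ≤ q × q < b) → Owner _≼_ k i q
    own {i = i} {q} S (p , p′) with ≤-total i q
    ... | inj₁ i≤q = H.owner⇒ S i≤q (p , p′)
    ... | inj₂ q≤i = swapOwner {_≼_ = flip _≼_} (V.owner⇒ (flipSpec {_≼_ = _≼_} S) q≤i (p′ , p))

    owner : ∀ i q → ∃[ k ] Owner _≼_ k i q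
    owner i q with ≤-total i q
    ... | inj₁ i≤q = H.firstOwner i≤q
    ... | inj₂ q≤i with V.firstOwner q≤i
    ...   | k , o = k , swapOwner {_≼_ = flip _≼_} o

    t≤n : ∀ {k a c t b} → Spec n _≼_ k a c t b → t ≤ n
    t≤n S = ≤-trans (Spec.t≤k S) (<⇒≤ (<-≤-trans (Spec.k<b S) (Spec.b≤n S)))

    t<b : ∀ {k a c t b} → Spec n _≼_ k a c t b → t < b
    t<b S = ≤-<-trans (Spec.t≤k S) (Spec.k<b S)

    a<c : ∀ {k a c t b} → Spec n _≼_ k a c t b → a < c
    a<c S = ≤-<-trans (Spec.l≤k S) (Spec.k<r S)

    hEdge⇒ : ∀ {g i} → suc g < n → HEdge R (n ∸ suc g) i → Sep _≼_ i g
    hEdge⇒ {g} {i} g<n e with find e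
    ... | _ , r∈R , p with sound r∈R
    hEdge⇒ {g} {i} g<n e | _ , r∈R , (p , inj₁ eq) | k , k<n , (a , c , t , b , S , refl)
      with ∸-cancelˡ-≡ (<⇒≤ g<n) (Spec.b≤n S) eq
    ... | refl = k , inj₁ (own S (p , s≤s⁻¹ (t<b S) , ≤-refl) , ¬o)
      where
      ¬o : ¬ Owner _≼_ k i (suc g)
      ¬o o = <-irrefl refl (proj₂ (proj₂ (cols-rows S (<-≤-trans (proj₂ p) (Spec.r≤n S)) g<n o)))
    hEdge⇒ {g} {i} g<n e | _ , r∈R , (p , inj₂ eq) | k , k<n , (a , c , t , b , S , refl)
      with ∸-cancelˡ-≡ (<⇒≤ g<n) (t≤n S) eq
    ... | refl = k , inj₂ (¬o , own S (p , ≤-refl , t<b S))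
      where
      ¬o : ¬ Owner _≼_ k i g
      ¬o o = <-irrefl refl (proj₁ (proj₂ (cols-rows S (<-≤-trans (proj₂ p) (Spec.r≤n S)) (<-trans ≤-refl g<n) o)))

    hEdge⇐ : ∀ {g i} → suc g < n → i < n → Sep _≼_ i g → HEdge R (n ∸ suc g) i
    hEdge⇐ {g} {i} g<n i<n (k , inj₁ (o , ¬o)) with complete (H.ownerBound i<n (<-trans ≤-refl g<n) o)
    ... | _ , r∈R , (a , c , t , b , S , refl) with cols-rows S i<n (<-trans ≤-refl g<n) o
    ...   | p , t≤g , g<b with m≤n⇒m<n∨m≡n g<b
    ...     | inj₁ 1+g<b = ⊥-elim (¬o (own S (p , m≤n⇒m≤1+n t≤g , 1+g<b)))
    ...     | inj₂ refl  = lose r∈R (p , inj₁ refl)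
    hEdge⇐ {g} {i} g<n i<n (k , inj₂ (¬o , o)) with complete (H.ownerBound i<n g<n o)
    ... | _ , r∈R , (a , c , t , b , S , refl) with cols-rows S i<n g<n o
    ...   | p , t≤1+g , 1+g<b with m≤n⇒m<n∨m≡n t≤1+g
    ...     | inj₁ t<1+g = ⊥-elim (¬o (own S (p , s≤s⁻¹ t<1+g , <-trans ≤-refl 1+g<b)))
    ...     | inj₂ refl  = lose r∈R (p , inj₂ refl)

    vSep⇒ : ∀ {g q} → suc g < n → q < n → VEdge R (suc g) (n ∸ suc q) → Sep (flip _≼_) q g
    vSep⇒ {g} {q} g<n q<n e with find e
    ... | _ , r∈R , p with sound r∈R
    vSep⇒ {g} {q} g<n q<n e | _ , r∈R , ((u , v) , inj₁ eq) | k , k<n , (a , c , t , b , S , refl)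
      with eq
    ... | refl = k , inj₂ (¬o , swapOwner {_≼_ = _≼_} (own S ((≤-refl , a<c S) , rows q<n u v)))
      where
      ¬o : ¬ Owner (flip _≼_) k q g
      ¬o o = <-irrefl refl (proj₁ (proj₁ (cols-rows S (<-trans ≤-refl g<n) q<n (swapOwner {_≼_ = flip _≼_} o))))
    vSep⇒ {g} {q} g<n q<n e | _ , r∈R , ((u , v) , inj₂ eq) | k , k<n , (a , c , t , b , S , refl)
      with eq
    ... | refl = k , inj₁ (swapOwner {_≼_ = _≼_} (own S ((s≤s⁻¹ (a<c S) , ≤-refl) , rows q<n u v)) , ¬o)
      where
      ¬o : ¬ Owner (flip _≼_) k q (suc g)
      ¬o o = <-irrefl refl (proj₂ (proj₁ (cols-rows S g<n q<n (swapOwner {_≼_ = flip _≼_} o))))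

    vSep⇐ : ∀ {g q} → suc g < n → q < n → Sep (flip _≼_) q g → VEdge R (suc g) (n ∸ suc q)
    vSep⇐ {g} {q} g<n q<n (k , inj₁ (o , ¬o)) with complete (V.ownerBound q<n (<-trans ≤-refl g<n) o)
    ... | _ , r∈R , (a , c , t , b , S , refl)
      with cols-rows S (<-trans ≤-refl g<n) q<n (swapOwner {_≼_ = flip _≼_} o)
    ...   | (a≤g , g<c) , p@(t≤q , q<b) with m≤n⇒m<n∨m≡n g<c
    ...     | inj₁ 1+g<c = ⊥-elim (¬o (swapOwner {_≼_ = _≼_} (own S ((m≤n⇒m≤1+n a≤g , 1+g<c) , p))))
    ...     | inj₂ refl  = lose r∈R ((∸-monoʳ-≤ n q<b , ∸-< (s≤s t≤q) q<n) , inj₂ refl)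
    vSep⇐ {g} {q} g<n q<n (k , inj₂ (¬o , o)) with complete (V.ownerBound q<n g<n o)
    ... | _ , r∈R , (a , c , t , b , S , refl) with cols-rows S g<n q<n (swapOwner {_≼_ = flip _≼_} o)
    ...   | (a≤1+g , 1+g<c) , p@(t≤q , q<b) with m≤n⇒m<n∨m≡n a≤1+g
    ...     | inj₁ a<1+g = ⊥-elim (¬o (swapOwner {_≼_ = _≼_} (own S ((s≤s⁻¹ a<1+g , <-trans ≤-refl 1+g<c) , p))))
    ...     | inj₂ refl  = lose r∈R ((∸-monoʳ-≤ n q<b , ∸-< (s≤s t≤q) q<n) , inj₁ refl)

    hEdge<n : ∀ {y i} → HEdge R y i → i < n
    hEdge<n e with find e
    ... | _ , r∈R , ((_ , i<c) , _) with sound r∈R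
    ...   | k , k<n , (a , c , t , b , S , refl) = <-≤-trans i<c (Spec.r≤n S)

    vEdge<n : ∀ {x j} → VEdge R x j → j < n
    vEdge<n e with find e
    ... | _ , r∈R , ((_ , j<top) , _) with sound r∈R
    ...   | k , k<n , (a , c , t , b , S , refl) = <-≤-trans j<top (m∸n≤m n t)

    vEdge⇒ : ∀ {g j} → suc g < n → VEdge R (suc g) j → Sep (flip _≼_) (n ∸ suc j) g
    vEdge⇒ g<n e = vSep⇒ g<n (n∸1+m<n (vEdge<n e)) (subst (VEdge R _) (sym (row (vEdge<n e))) e)

    vEdge⇐ : ∀ {g j} → suc g < n → j < n → Sep (flip _≼_) (n ∸ suc j) g → VEdge R (suc g) j
    vEdge⇐ g<n j<n s = subst (VEdge R _) (row j<n) (vSep⇐ g<n (n∸1+m<n j<n) s)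

    hEdge? : ∀ y → Decidable (HEdge R y)
    hEdge? y i = any? (λ r → (left r ≤? i ×-dec i <? right r) ×-dec (y ≟ bottom r ⊎-dec y ≟ top r)) R

    vEdge? : ∀ x → Decidable (VEdge R x)
    vEdge? x j = any? (λ r → (bottom r ≤? j ×-dec j <? top r) ×-dec (x ≟ left r ⊎-dec x ≟ right r)) R

    isSubdivision : IsSubdivision n R
    isSubdivision = record { proper = All.tabulate proper ; covers = covers ; disjoint = disjoint }
      where
      proper : ∀ {r} → r ∈ R → (left r < right r × right r ≤ n) × (bottom r < top r × top r ≤ n)
      proper r∈R with sound r∈R
      ... | k , k<n , (a , c , t , b , S , refl) =
        (a<c S , Spec.r≤n S) , ∸-< (t<b S) (Spec.b≤n S) , m∸n≤m n t
      covers : ∀ {i j} → i < n → j < n → Any (HasCell i j) R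
      covers {i} {j} i<n j<n with owner i (n ∸ suc j)
      ... | k , o with complete (H.ownerBound i<n (n∸1+m<n j<n) o)
      ...   | r , r∈R , isRect =
        lose r∈R (subst (λ j → HasCell i j r) (row j<n) (cell⇐ isRect i<n (n∸1+m<n j<n) o))
      disjoint : ∀ {i j r s} → r ∈ R → s ∈ R → HasCell i j r → HasCell i j s → r ≡ s
      disjoint {i} {j} {r} {s} r∈R s∈R p p′ with sound r∈R | sound s∈R | proper r∈R
      ... | k , _ , isRect | k′ , _ , isRect′ | _ , _ , top≤n
        with H.ownerUnique (cell⇒ isRect (n∸1+m<n j<n) (subst (λ j → HasCell i j r) (sym (row j<n)) p))
                           (cell⇒ isRect′ (n∸1+m<n j<n) (subst (λ j → HasCell i j s) (sym (row j<n)) p′))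
        where j<n = <-≤-trans (proj₂ (proj₂ p)) top≤n
      ...   | refl = isRect-unique isRect isRect′

    height : ∀ {y} → 0 < y → y < n → ∃[ g ] (suc g < n × n ∸ suc g ≡ y)
    height {y} 0<y y<n = n ∸ suc y ,
      subst (_< n) (sym (1+[n∸1+m] y<n)) (∸-monoʳ-< 0<y (<⇒≤ y<n)) , row y<n

    noncrossing : ∀ {a c y b d x} → IsWall n R (horizontal a c y) → IsWall n R (vertical b d x) →
                  ¬ ((a < x × x < c) × (b < y × y < d))
    noncrossing {a} {c} {y} {b} {d} {suc x₀} ((0<y , y<n) , r) ((_ , x<n) , r′) ((a<x , x<c) , b<y , y<d)
      with height 0<y y<n
    ... | g , g<n , refl with x₀ ≤? g
    ...   | yes x₀≤g = lemma (H.sep⇒ (hEdge⇒ g<n (MaximalRun.within r (s≤s⁻¹ a<x) (<-trans ≤-refl x<c))))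
                             (V.sep⇒ (vSep⇒ x<n g<n (MaximalRun.within r′ b≤ <d)))
      where
      b≤ : b ≤ n ∸ suc (suc g)
      b≤ = s≤s⁻¹ (subst (b <_) (sym (1+[n∸1+m] g<n)) b<y)
      <d : n ∸ suc (suc g) < d
      <d = <-trans (subst (n ∸ suc (suc g) <_) (1+[n∸1+m] g<n) ≤-refl) y<d
      lemma : Sep′ _≼_ x₀ g → ¬ Sep′ (flip _≼_) (suc g) x₀
      lemma _ (inj₁ (g<x₀ , _)) = <⇒≱ g<x₀ x₀≤g
      lemma (inj₂ (g<x₀ , _)) _ = <⇒≱ g<x₀ x₀≤g
      lemma (inj₁ (_ , f)) (inj₂ (x₀<1+g , f′)) =
        <⇒≢ x₀<1+g (pos-injective (≤-antisym (f′ x₀<1+g ≤-refl) (f ≤-refl x₀≤g)))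
    ...   | no x₀≰g = lemma (H.sep⇒ (hEdge⇒ g<n (MaximalRun.within r (<⇒≤ a<x) x<c)))
                            (V.sep⇒ (vSep⇒ x<n (<-trans ≤-refl g<n) (MaximalRun.within r′ (<⇒≤ b<y) y<d)))
      where
      g<x₀ = ≰⇒> x₀≰g
      lemma : Sep′ _≼_ (suc x₀) g → ¬ Sep′ (flip _≼_) g x₀
      lemma _ (inj₂ (x₀<g , _)) = <-asym x₀<g g<x₀
      lemma (inj₁ (x₀<g , _)) _ = <-asym x₀<g g<x₀
      lemma (inj₂ (g<x , f)) (inj₁ (g≤x₀ , f′)) =
        <⇒≢ g<x (pos-injective (≤-antisym (f′ ≤-refl g≤x₀) (f g<x ≤-refl)))

    wallHasPoint : ∀ w → IsWall n R w → ∃[ i ] (1 ≤ i × i < n × w ∋[ i , n ∸ i ])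
    wallHasPoint (horizontal a c y) ((0<y , y<n) , r) with height 0<y y<n
    ... | g , g<n , refl = suc g , z<s , g<n , refl , Run.towards up down r
      where
      up : ∀ {i} → suc i < suc g → HEdge R (n ∸ suc g) i → HEdge R (n ∸ suc g) (suc i)
      up i<g e = hEdge⇐ g<n (<-trans i<g g<n) (H.sep-up (s≤s⁻¹ i<g) (hEdge⇒ g<n e))
      down : ∀ {i} → suc g ≤ i → HEdge R (n ∸ suc g) (suc i) → HEdge R (n ∸ suc g) i
      down g<i e = hEdge⇐ g<n (<-trans ≤-refl (hEdge<n e)) (H.sep-down g<i (hEdge⇒ g<n e))
    wallHasPoint (vertical b d (suc g)) ((_ , g<n) , r) =
      suc g , z<s , g<n , refl , Run.towards up down r
      where
      up : ∀ {j} → suc j < n ∸ suc g → VEdge R (suc g) j → VEdge R (suc g) (suc j)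
      up {j} j< e = vEdge⇐ g<n j<n (V.sep-down
          (subst (_≤ n ∸ suc (suc j)) (∸∸ (<⇒≤ g<n)) (∸-monoʳ-≤ n j<))
          (subst (λ q → Sep (flip _≼_) q g) (sym (1+[n∸1+m] j<n)) (vEdge⇒ g<n e)))
        where j<n = <-≤-trans j< (m∸n≤m n (suc g))
      down : ∀ {j} → n ∸ suc g ≤ j → VEdge R (suc g) (suc j) → VEdge R (suc g) j
      down {j} ≤j e = vEdge⇐ g<n (<-trans ≤-refl j<n)
          (subst (λ q → Sep (flip _≼_) q g) (1+[n∸1+m] j<n) (V.sep-up q≤g (vEdge⇒ g<n e)))
        where
        j<n = vEdge<n e
        q≤g : suc (n ∸ suc (suc j)) ≤ g
        q≤g = subst (_≤ g) (sym (1+[n∸1+m] j<n))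
                (subst (n ∸ suc j ≤_) (row (<-trans ≤-refl g<n)) (∸-monoʳ-≤ n (s≤s ≤j)))

    pointOnWall : ∀ {i} → 1 ≤ i → i < n → ∃! _≡_ λ w → IsWall n R w × w ∋[ i , n ∸ i ]
    pointOnWall {suc g} _ g<n with ≤-total (pos (suc g)) (pos g)
    ... | inj₁ 1+g≼g with Run.exists (hEdge? (n ∸ suc g)) hEdge<n edge
      where
      edge : HEdge R (n ∸ suc g) g
      edge = hEdge⇐ g<n (<-trans ≤-refl g<n) (H.sep-left 1+g≼g)
    ...   | a , c , a≤g , g<c , r =
      horizontal a c (n ∸ suc g) ,
      (((m<n⇒0<n∸m g<n , n∸1+m<n (<-trans ≤-refl g<n)) , r) , refl , m≤n⇒m≤1+n a≤g , g<c) , unique _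
      where
      unique : ∀ w → IsWall n R w × w ∋[ suc g , n ∸ suc g ] → horizontal a c (n ∸ suc g) ≡ w
      unique (horizontal a′ c′ _) ((_ , r′) , refl , a′≤ , ≤c′)
        with Run.contains (MaximalRun.within r a≤g g<c) r′ a′≤ ≤c′
      ... | a′≤g , g<c′ with Run.unique r r′ a≤g g<c a′≤g g<c′
      ...   | refl , refl = refl
      unique (vertical b d _) ((_ , r′) , refl , _) = ⊥-elim (1+n≢n (pos-injective (≤-antisym 1+g≼g
        (V.sep-dir (vEdge⇒ g<n (MaximalRun.within r′ ≤-refl (MaximalRun.nonempty r′)))))))
    pointOnWall {suc g} _ g<n | inj₂ g≼1+g with Run.exists (vEdge? (suc g)) vEdge<n edge
      where
      edge : VEdge R (suc g) (n ∸ suc (suc g))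
      edge = vSep⇐ g<n g<n (V.sep-right g≼1+g)
    ...   | b , d , b≤j , j<d , r =
      vertical b d (suc g) ,
      (((z<s , g<n) , r) , refl , subst (b ≤_) eq (m≤n⇒m≤1+n b≤j) , subst (_≤ d) eq j<d) , unique _
      where
      eq = 1+[n∸1+m] g<n
      unique : ∀ w → IsWall n R w × w ∋[ suc g , n ∸ suc g ] → vertical b d (suc g) ≡ w
      unique (vertical b′ d′ _) ((_ , r′) , refl , b′≤ , ≤d′)
        with Run.contains (MaximalRun.within r b≤j j<d) r′ (subst (b′ ≤_) (sym eq) b′≤) (subst (_≤ d′) (sym eq) ≤d′)
      ... | b′≤j , j<d′ with Run.unique r r′ b≤j j<d b′≤j j<d′
      ...   | refl , refl = refl
      unique (horizontal a c _) ((_ , r′) , refl , _) = ⊥-elim (1+n≢n (pos-injective (≤-antisym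
        (H.sep-dir (hEdge⇒ g<n (MaximalRun.within r′ ≤-refl (MaximalRun.nonempty r′)))) g≼1+g)))

drawn-isDiagonal : ∀ {n} (x : Permutation′ n) → IsDiagonal n (drawn x n ≤-refl)
drawn-isDiagonal x = record
  { subdivision  = isSubdivision
  ; noncrossing  = noncrossing
  ; wallHasPoint = wallHasPoint
  ; pointOnWall  = pointOnWall
  }
  where open WellDefined.Drawing x

ρ : ∀ {n} → Permutation′ n → DRec n
ρ {n} x = dRec (drawn x n ≤-refl) (drawn-isDiagonal x)

{-# OPTIONS --safe #-}
-- The cell of ρ x in column i and row r, counted from the top, belongs to
-- the first (if i ≤ r) or last (if r ≤ i) entry of x with value between i
-- and r.  Hence ρ x and ρ y agree if and only if, for every interval of
-- values, the first and the last entry of x and y in it agree.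
-- Exchanging two adjacent entries u and v preserves these data precisely
-- if some value between u and v occurs before them and some occurs after
-- them, that is, if the exchange is one of the two moves or its inverse.
-- If x ≠ y have the same data, and v is adjacent to and after u in x but
-- before u in y, then neither u nor v is the first or the last entry in
-- the interval between them, so they can be exchanged in x.  Sorting x
-- into y by such exchanges connects x and y by moves.
module Submission where

open import Data.Fin.Base as Fin using (Fin; toℕ; fromℕ<)
open import Data.Fin.Permutation using (Permutation′; _⟨$⟩ʳ_; _⟨$⟩ˡ_; _≈_; _∘ₚ_; transpose; inverseˡ; inverseʳ)
open import Data.Fin.Properties using (_≟_; <-cmp; toℕ<n; toℕ-injective; toℕ-fromℕ<)
open import Data.List.Membership.Propositional using (_∈_)
open import Data.List.Relation.Unary.All as All using ()
open import Data.Nat.Base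
open import Data.Nat.Properties hiding (_≟_; <-cmp)
open import Data.Product.Base using (_×_; _,_; proj₁; proj₂; ∃-syntax)
open import Data.Sum.Base using (_⊎_; inj₁; inj₂; [_,_]′)
open import Function.Base using (_∘_; id)
open import Function.Bundles using (_⇔_; mk⇔; Equivalence)
open import Relation.Binary.Construct.Closure.Equivalence as EqClosure using ()
open import Relation.Binary.Definitions using (tri<; tri≈; tri>)
open import Relation.Binary.PropositionalEquality
open import Relation.Binary.Structures using (IsEquivalence)
open import Relation.Nullary using (yes; no; contradiction)
open import Defs using (Θ-tB; ρ; _≈ᴿ_; Rect; rect; HasCell; Move₃₄₁₂→₃₁₄₂; Move₂₄₁₃→₂₁₄₃; IsSubdivision; module WellDefined)
open Rect
open WellDefined using (Owner; swapOwner; row; n∸1+m<n; module Drawing)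

-- Transpositions of positions, and positions of entries

-- The graph of `transpose p q`, so that later arguments match on three cases instead of unfolding
-- nested equality tests.
data Transposed {n} (p q : Fin n) (i i′ : Fin n) : Set where
  fst   : i ≡ p → i′ ≡ q → Transposed p q i i′
  snd   : i ≡ q → i′ ≡ p → Transposed p q i i′
  other : i ≢ p → i ≢ q → i′ ≡ i → Transposed p q i i′

module _ {n} (p q : Fin n) where

  transposed : ∀ i → Transposed p q i (transpose p q ⟨$⟩ʳ i)
  transposed i with i ≟ p
  ... | yes i≡p = fst i≡p refl
  ... | no  i≢p with i ≟ q
  ...   | yes i≡q = snd i≡q refl
  ...   | no  i≢q = other i≢p i≢q refl

  transposed-sym : ∀ {i i′} → Transposed p q i i′ → Transposed p q i′ i
  transposed-sym (fst a b)        = snd b a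
  transposed-sym (snd a b)        = fst b a
  transposed-sym (other a b refl) = other a b refl

  transposed-functional : ∀ {i i′ i″} → Transposed p q i i′ → Transposed p q i i″ → i′ ≡ i″
  transposed-functional (fst _ b)    (fst _ d)    = trans b (sym d)
  transposed-functional (fst a b)    (snd c d)    = trans b (trans (sym c) (trans a (sym d)))
  transposed-functional (fst a _)    (other c _ _) = contradiction a c
  transposed-functional (snd a b)    (fst c d)    = trans b (trans (sym c) (trans a (sym d)))
  transposed-functional (snd _ b)    (snd _ d)    = trans b (sym d)
  transposed-functional (snd a _)    (other _ d _) = contradiction a d
  transposed-functional (other a _ _) (fst c _)   = contradiction c a
  transposed-functional (other _ b _) (snd c _)   = contradiction c b
  transposed-functional (other _ _ e) (other _ _ f) = trans e (sym f)

  transpose-fst : transpose p q ⟨$⟩ʳ p ≡ q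
  transpose-fst = transposed-functional (transposed p) (fst refl refl)

  transpose-snd : transpose p q ⟨$⟩ʳ q ≡ p
  transpose-snd = transposed-functional (transposed q) (snd refl refl)

  transpose-other : ∀ {i} → i ≢ p → i ≢ q → transpose p q ⟨$⟩ʳ i ≡ i
  transpose-other i≢p i≢q = transposed-functional (transposed _) (other i≢p i≢q refl)

  transpose-involutive : ∀ i → transpose p q ⟨$⟩ʳ (transpose p q ⟨$⟩ʳ i) ≡ i
  transpose-involutive i = transposed-functional (transposed _) (transposed-sym (transposed i))

  -- No position lies strictly between `p` and `q`, so exchanging them alters no comparison with a
  -- third position.
  transposed-mono : toℕ q ≡ suc (toℕ p) → ∀ {i i′ j j′} → Transposed p q i i′ → Transposed p q j j′ →
                    i Fin.≤ j → (i ≡ p × j ≡ q) ⊎ i′ Fin.≤ j′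
  transposed-mono p⋖q (fst refl refl) (fst refl refl) _ = inj₂ ≤-refl
  transposed-mono p⋖q (fst refl refl) (snd refl refl) _ = inj₁ (refl , refl)
  transposed-mono p⋖q {j = j} (fst refl refl) (other j≢p _ refl) p≤j =
    inj₂ (subst (_≤ toℕ j) (sym p⋖q) (≤∧≢⇒< p≤j (j≢p ∘ sym ∘ toℕ-injective)))
  transposed-mono p⋖q (snd refl refl) (fst refl refl) q≤p = contradiction (subst (_≤ toℕ p) p⋖q q≤p) 1+n≰n
  transposed-mono p⋖q (snd refl refl) (snd refl refl) _ = inj₂ ≤-refl
  transposed-mono p⋖q {j = j} (snd refl refl) (other _ _ refl) q≤j =
    inj₂ (<⇒≤ (subst (_≤ toℕ j) p⋖q q≤j))
  transposed-mono p⋖q {i = i} (other _ _ refl) (fst refl refl) i≤p =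
    inj₂ (subst (toℕ i ≤_) (sym p⋖q) (m≤n⇒m≤1+n i≤p))
  transposed-mono p⋖q {i = i} (other _ i≢q refl) (snd refl refl) i≤q =
    inj₂ (s≤s⁻¹ (subst (toℕ i <_) p⋖q (≤∧≢⇒< i≤q (i≢q ∘ toℕ-injective))))
  transposed-mono p⋖q (other _ _ refl) (other _ _ refl) i≤j = inj₂ i≤j

module _ {n} (x : Permutation′ n) where

  entry-injective : ∀ {i j} → x ⟨$⟩ʳ i ≡ x ⟨$⟩ʳ j → i ≡ j
  entry-injective eq = trans (sym (inverseˡ x)) (trans (cong (x ⟨$⟩ˡ_) eq) (inverseˡ x))

  pos-value : ∀ {i k} → x ⟨$⟩ʳ i ≡ k → Drawing.pos x (toℕ k) ≡ toℕ i
  pos-value {i} refl = trans (Drawing.pos-fin x _) (cong toℕ (inverseˡ x))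

  value-at : ∀ {k} → k < n → ∃[ i ] k ≡ toℕ (x ⟨$⟩ʳ i)
  value-at k<n = x ⟨$⟩ˡ fromℕ< k<n , trans (sym (toℕ-fromℕ< k<n)) (cong toℕ (sym (inverseʳ x)))

-- Cell owners and rectangulations determine each other

record SameOwners {n} (x y : Permutation′ n) : Set where
  constructor mkSame
  field
    transfer : ∀ {k i r} → i < n → r < n → Owner (Drawing._≼_ x) k i r → Owner (Drawing._≼_ y) k i r

open SameOwners

SameOwners-isEquivalence : ∀ {n} → IsEquivalence (SameOwners {n})
SameOwners-isEquivalence {n} = record
  { refl  = mkSame λ _ _ o → o
  ; sym   = same-sym
  ; trans = λ s s′ → mkSame λ i<n r<n o → transfer s′ i<n r<n (transfer s i<n r<n o)
  }
  where
  -- Each cell has an owner in `x`. Transferred to `y`, where owners are unique, it must be the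
  -- given one.
  same-sym : ∀ {x y : Permutation′ n} → SameOwners x y → SameOwners y x
  same-sym {x} {y} s = mkSame back
    where
    back : ∀ {k i r} → i < n → r < n → Owner (Drawing._≼_ y) k i r → Owner (Drawing._≼_ x) k i r
    back {k} {i} {r} i<n r<n o with Drawing.owner x i r
    ... | k′ , o′ = subst (λ k → Owner (Drawing._≼_ x) k i r)
                      (Drawing.H.ownerUnique y (transfer s i<n r<n o′) o) o′

module Same {n} = IsEquivalence (SameOwners-isEquivalence {n})

-- Listed rectangles carry no labels, so the label in `y` has to be recovered. Only `k` can own the
-- diagonal cell in column and row `k`, so a common rectangle containing that cell has label `k` in
-- both drawings.
ρ⇒sameOwners : ∀ {n} {x y : Permutation′ n} → ρ x ≈ᴿ ρ y → SameOwners x y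
ρ⇒sameOwners {n} {x} {y} eq = mkSame go
  where
  module X = Drawing x
  module Y = Drawing y
  go : ∀ {k i r} → i < n → r < n → Owner X._≼_ k i r → Owner Y._≼_ k i r
  go {k} {i} {r} i<n r<n o with X.complete (X.H.ownerBound i<n r<n o)
  ... | _ , s∈X , isRect with Y.sound (Equivalence.to eq s∈X)
  ...   | k′ , _ , isRect′ with X.owner k k
  ...     | k″ , diag with X.H.asFirst ≤-refl diag
  ...       | k≤k″ , k″≤k , _ with ≤-antisym k≤k″ k″≤k
  ...         | refl with Y.H.asFirst ≤-refl (Y.cell⇒ isRect′ k<n (X.cell⇐ isRect k<n k<n diag))
    where k<n = X.H.ownerBound i<n r<n o
  ...           | k≤k′ , k′≤k , _ with ≤-antisym k≤k′ k′≤k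
  ...             | refl = Y.cell⇒ isRect′ r<n (X.cell⇐ isRect i<n r<n o)

Proper : ℕ → Rect → Set
Proper n r = (left r < right r × right r ≤ n) × (bottom r < top r × top r ≤ n)

-- The bottom-left and top-right cells of `r` suffice; they exist because `r` is proper.
cells⊆ : ∀ {n r s} → Proper n r → (∀ {i j} → i < n → j < n → HasCell i j r → HasCell i j s) →
         (left s ≤ left r × right r ≤ right s) × (bottom s ≤ bottom r × top r ≤ top s)
cells⊆ {r = rect a (suc c) b (suc d)} ((a<c , c≤n) , (b<d , d≤n)) ⊆
  with ⊆ (<-≤-trans a<c c≤n) (<-≤-trans b<d d≤n) ((≤-refl , a<c) , (≤-refl , b<d))
     | ⊆ c≤n d≤n ((s≤s⁻¹ a<c , ≤-refl) , (s≤s⁻¹ b<d , ≤-refl))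
... | (a≤ , _) , (b≤ , _) | (_ , ≤c) , (_ , ≤d) = (a≤ , ≤c) , (b≤ , ≤d)

rect-ext : ∀ {n r s} → Proper n r → Proper n s →
           (∀ {i j} → i < n → j < n → HasCell i j r → HasCell i j s) →
           (∀ {i j} → i < n → j < n → HasCell i j s → HasCell i j r) → r ≡ s
rect-ext pr ps ⊆ ⊇ with cells⊆ pr ⊆ | cells⊆ ps ⊇
... | (a , c) , (b , d) | (a′ , c′) , (b′ , d′)
  with ≤-antisym a a′ | ≤-antisym c c′ | ≤-antisym b b′ | ≤-antisym d d′
... | refl | refl | refl | refl = refl

sameOwners⇒⊆ : ∀ {n} {x y : Permutation′ n} → SameOwners x y →
               ∀ {r} → r ∈ Drawing.R x → r ∈ Drawing.R y
sameOwners⇒⊆ {n} {x} {y} same {r} r∈X with Drawing.sound x r∈X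
... | k , k<n , isRect with Drawing.complete y k<n
...   | s , s∈Y , isRect′ = subst (_∈ Drawing.R y)
          (sym (rect-ext (All.lookup (IsSubdivision.proper (Drawing.isSubdivision x)) r∈X)
                         (All.lookup (IsSubdivision.proper (Drawing.isSubdivision y)) s∈Y)
                         (cells x y same isRect isRect′)
                         (cells y x (Same.sym same) isRect′ isRect))) s∈Y
  where
  cells : ∀ (x y : Permutation′ n) → SameOwners x y →
          ∀ {k r s} → Drawing.IsRect x k r → Drawing.IsRect y k s →
          ∀ {i j} → i < n → j < n → HasCell i j r → HasCell i j s
  cells x y same {k} {r} {s} isRect isRect′ {i} {j} i<n j<n c =
    subst (λ j → HasCell i j s) (row j<n) (Drawing.cell⇐ y isRect′ i<n q<n
      (transfer same i<n q<n (Drawing.cell⇒ x isRect q<n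
        (subst (λ j → HasCell i j r) (sym (row j<n)) c))))
    where q<n = n∸1+m<n j<n

sameOwners⇒ρ : ∀ {n} {x y : Permutation′ n} → SameOwners x y → ρ x ≈ᴿ ρ y
sameOwners⇒ρ same = mk⇔ (sameOwners⇒⊆ same) (sameOwners⇒⊆ (Same.sym same))

-- Moves preserve owners

-- The common core of the two moves: `before` and `after` hold the middle values `b` and `c`, in
-- either order. The bounds `lo` and `hi` are separate parameters so that ascents and descents at
-- `p`, `q` are both covered.
record Straddled {n} (x : Permutation′ n) (p q : Fin n) (lo hi : ℕ) : Set where
  field
    {before after} : Fin n
    before<p : before Fin.< p
    q<after  : q Fin.< after
    lo<before : lo < toℕ (x ⟨$⟩ʳ before)
    before<hi : toℕ (x ⟨$⟩ʳ before) < hi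
    lo<after  : lo < toℕ (x ⟨$⟩ʳ after)
    after<hi  : toℕ (x ⟨$⟩ʳ after) < hi

≈⇒sameOwners : ∀ {n} {x y : Permutation′ n} → x ≈ y → SameOwners x y
≈⇒sameOwners {n} {x} {y} x≈y = mkSame λ
  { i<n r<n (inj₁ (i≤r , i≤k , k≤r , f)) → inj₁ (i≤r , i≤k , k≤r , λ p q →
      order (≤-<-trans k≤r r<n) (≤-<-trans q r<n) (f p q))
  ; i<n r<n (inj₂ (r≤i , r≤k , k≤i , f)) → inj₂ (r≤i , r≤k , k≤i , λ p q →
      order (≤-<-trans q i<n) (≤-<-trans k≤i i<n) (f p q))
  }
  where
  pos≡ : ∀ {k} → k < n → Drawing.pos x k ≡ Drawing.pos y k
  pos≡ k<n with value-at x k<n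
  ... | i , refl = trans (pos-value x refl) (sym (pos-value y (sym (x≈y i))))
  order : ∀ {k m} → k < n → m < n → Drawing._≼_ x k m → Drawing._≼_ y k m
  order k<n m<n = subst₂ _≤_ (pos≡ k<n) (pos≡ m<n)

-- Only the comparison of the entries at `p` and `q` changes. This could matter only if the entry at
-- `p` were first, or the entry at `q` last, in an interval of values containing both. Such an
-- interval also contains the entries at `before` and `after`, which lie further out.
straddled⇒sameOwners : ∀ {n} {x y : Permutation′ n} {p q} → toℕ q ≡ suc (toℕ p) →
  Straddled y p q (toℕ (y ⟨$⟩ʳ q)) (toℕ (y ⟨$⟩ʳ p)) → x ≈ transpose p q ∘ₚ y → SameOwners y x
straddled⇒sameOwners {n} {x} {y} {p} {q} p⋖q S swapped = mkSame λ
  { i<n r<n (inj₁ (i≤r , i≤k , k≤r , f)) → inj₁ (i≤r , i≤k , k≤r , λ i≤m m≤r →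
      [ (λ { (refl , refl) → contradiction (f (<⇒≤ (≤-<-trans i≤m lo<before)) (<⇒≤ (<-≤-trans before<hi k≤r)))
               (<⇒≱ (subst₂ _<_ (sym (pos-value y refl)) (sym (pos-value y refl)) before<p)) })
      , id ]′ (order (≤-<-trans k≤r r<n) (≤-<-trans m≤r r<n) (f i≤m m≤r)))
  ; i<n r<n (inj₂ (r≤i , r≤k , k≤i , f)) → inj₂ (r≤i , r≤k , k≤i , λ r≤m m≤i →
      [ (λ { (refl , refl) → contradiction (f (<⇒≤ (≤-<-trans r≤k lo<after)) (<⇒≤ (<-≤-trans after<hi m≤i)))
               (<⇒≱ (subst₂ _<_ (sym (pos-value y refl)) (sym (pos-value y refl)) q<after)) })
      , id ]′ (order (≤-<-trans m≤i i<n) (≤-<-trans k≤i i<n) (f r≤m m≤i)))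
  }
  where
  open Straddled S
  pos-x : ∀ i → Drawing.pos x (toℕ (y ⟨$⟩ʳ i)) ≡ toℕ (transpose p q ⟨$⟩ʳ i)
  pos-x i = pos-value x (trans (swapped _) (cong (y ⟨$⟩ʳ_) (transpose-involutive p q i)))
  order : ∀ {k m} → k < n → m < n → Drawing._≼_ y k m →
          (k ≡ toℕ (y ⟨$⟩ʳ p) × m ≡ toℕ (y ⟨$⟩ʳ q)) ⊎ Drawing._≼_ x k m
  order k<n m<n k≼m with value-at y k<n | value-at y m<n
  ... | i , refl | j , refl
    with transposed-mono p q p⋖q (transposed p q i) (transposed p q j) (subst₂ _≤_ (pos-value y refl) (pos-value y refl) k≼m)
  ...   | inj₁ (refl , refl) = inj₁ (refl , refl)
  ...   | inj₂ τi≤τj = inj₂ (subst₂ _≤_ (sym (pos-x i)) (sym (pos-x j)) τi≤τj)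

Θ⇒sameOwners : ∀ {n} {x y : Permutation′ n} → Θ-tB x y → SameOwners x y
Θ⇒sameOwners = EqClosure.fold SameOwners-isEquivalence λ
  { (inj₁ x≈y)        → ≈⇒sameOwners x≈y
  ; (inj₂ (inj₁ m)) → let open Move₃₄₁₂→₃₁₄₂ m in Same.sym (straddled⇒sameOwners pd⋖pa record
      { before<p  = pc<pd
      ; q<after   = pa<pb
      ; lo<before = <-trans a<b b<c
      ; before<hi = c<d
      ; lo<after  = a<b
      ; after<hi  = <-trans b<c c<d
      } swapped)
  ; (inj₂ (inj₂ m)) → let open Move₂₄₁₃→₂₁₄₃ m in Same.sym (straddled⇒sameOwners pd⋖pa record
      { before<p  = pb<pd
      ; q<after   = pa<pc
      ; lo<before = a<b
      ; before<hi = <-trans b<c c<d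
      ; lo<after  = <-trans a<b b<c
      ; after<hi  = c<d
      } swapped)
  }

-- Adjacent inversions are moves

-- The witness at `before` is the smaller of the two in the pattern 2413 and the larger in 3412, so
-- comparing them selects the move.
straddled⇒Θ : ∀ {n} {x y : Permutation′ n} {p q} → toℕ q ≡ suc (toℕ p) →
  Straddled y p q (toℕ (y ⟨$⟩ʳ q)) (toℕ (y ⟨$⟩ʳ p)) → x ≈ transpose p q ∘ₚ y → Θ-tB x y
straddled⇒Θ {x = x} {y} {p} {q} p⋖q S swapped with <-cmp (y ⟨$⟩ʳ before) (y ⟨$⟩ʳ after)
  where open Straddled S
... | tri< b<c _ _ = EqClosure.return (inj₂ (inj₂ record
  { pb<pd = before<p ; pd⋖pa = p⋖q ; pa<pc = q<after
  ; a<b = lo<before ; b<c = b<c ; c<d = after<hi ; swapped = swapped }))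
  where open Straddled S
... | tri> _ _ b<c = EqClosure.return (inj₂ (inj₁ record
  { pc<pd = before<p ; pd⋖pa = p⋖q ; pa<pb = q<after
  ; a<b = lo<after ; b<c = b<c ; c<d = before<hi ; swapped = swapped }))
  where open Straddled S
... | tri≈ _ eq _ = contradiction (cong toℕ (entry-injective y eq))
  (<⇒≢ (<-trans before<p (<-trans (≤-reflexive (sym p⋖q)) q<after)))
  where open Straddled S

-- Moves start from the permutation with the descent. If `x` has an ascent, that is the exchanged
-- permutation; the exchange fixes both witnesses.
straddled-swap : ∀ {n} {x : Permutation′ n} {p q} → toℕ q ≡ suc (toℕ p) →
  Straddled x p q (toℕ (x ⟨$⟩ʳ p)) (toℕ (x ⟨$⟩ʳ q)) → let x′ = transpose p q ∘ₚ x in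
  Straddled x′ p q (toℕ (x′ ⟨$⟩ʳ q)) (toℕ (x′ ⟨$⟩ʳ p))
straddled-swap {x = x} {p} {q} p⋖q S
  rewrite transpose-fst p q | transpose-snd p q = record
  { before<p  = before<p
  ; q<after   = q<after
  ; lo<before = subst (λ i → _ < toℕ (x ⟨$⟩ʳ i)) (sym fixed-before) lo<before
  ; before<hi = subst (λ i → toℕ (x ⟨$⟩ʳ i) < _) (sym fixed-before) before<hi
  ; lo<after  = subst (λ i → _ < toℕ (x ⟨$⟩ʳ i)) (sym fixed-after) lo<after
  ; after<hi  = subst (λ i → toℕ (x ⟨$⟩ʳ i) < _) (sym fixed-after) after<hi
  }
  where
  open Straddled S
  p<q : p Fin.< q
  p<q = ≤-reflexive (sym p⋖q)
  fixed-before : transpose p q ⟨$⟩ʳ before ≡ before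
  fixed-before = transpose-other p q (<⇒≢ before<p ∘ cong toℕ) (<⇒≢ (<-trans before<p p<q) ∘ cong toℕ)
  fixed-after : transpose p q ⟨$⟩ʳ after ≡ after
  fixed-after = transpose-other p q (>⇒≢ (<-trans p<q q<after) ∘ cong toℕ) (>⇒≢ q<after ∘ cong toℕ)

module _ {n} {x y : Permutation′ n} (same : SameOwners x y) where

  private
    module X = Drawing x
    module Y = Drawing y

  -- Let `u` and `v` be the entries of `x` at `p` and `q`. The first entry in the interval is the
  -- same in `x` and `y`. It is not `v`, which `u` precedes in `x`, nor `u`, which `v` precedes in
  -- `y`; so its value is strictly inside and it comes before `u` in `x`. The last entry is treated
  -- dually.
  inversion⇒straddled : ∀ {p q lo hi} → p Fin.< q →
    Y.pos (toℕ (x ⟨$⟩ʳ q)) < Y.pos (toℕ (x ⟨$⟩ʳ p)) → lo ≤ hi → hi < n →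
    (lo ≡ toℕ (x ⟨$⟩ʳ p) × hi ≡ toℕ (x ⟨$⟩ʳ q)) ⊎ (lo ≡ toℕ (x ⟨$⟩ʳ q) × hi ≡ toℕ (x ⟨$⟩ʳ p)) →
    Straddled x p q lo hi
  inversion⇒straddled {p} {q} {lo} {hi} p<q v<u lo≤hi hi<n ends
    with X.H.firstOwner lo≤hi | X.V.firstOwner lo≤hi
  -- The first label owns the cell in column `lo` and row `hi`, the last label the cell in column
  -- `hi` and row `lo`.
  ... | k , o | m , o′ with transfer same lo<n hi<n o
    | transfer same hi<n lo<n (swapOwner {_≼_ = λ k l → X._≼_ l k} o′)
    where lo<n = ≤-<-trans lo≤hi hi<n
  ... | oʸ | oʸ′ with X.H.asFirst lo≤hi o | Y.H.asFirst lo≤hi oʸ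
                    | X.V.asFirst lo≤hi o′ | Y.H.asLast lo≤hi oʸ′
  ... | lo≤k , k≤hi , f | _ , _ , fʸ | lo≤m , m≤hi , g | _ , _ , gʸ
    with value-at x (≤-<-trans k≤hi hi<n) | value-at x (≤-<-trans m≤hi hi<n)
  ... | i , refl | j , refl = record
    { before<p  = ≤∧≢⇒< i≤p (k≢u ∘ cong entry ∘ toℕ-injective)
    ; q<after   = ≤∧≢⇒< q≤j (m≢v ∘ sym ∘ cong entry ∘ toℕ-injective)
    ; lo<before = ≤∧≢⇒< lo≤k (proj₁ (inside k≢u k≢v) ∘ sym)
    ; before<hi = ≤∧≢⇒< k≤hi (proj₂ (inside k≢u k≢v))
    ; lo<after  = ≤∧≢⇒< lo≤m (proj₁ (inside m≢u m≢v) ∘ sym)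
    ; after<hi  = ≤∧≢⇒< m≤hi (proj₂ (inside m≢u m≢v))
    }
    where
    entry : Fin n → ℕ
    entry i = toℕ (x ⟨$⟩ʳ i)
    inInterval : ∀ {k} → k ≡ lo ⊎ k ≡ hi → lo ≤ k × k ≤ hi
    inInterval (inj₁ refl) = ≤-refl , lo≤hi
    inInterval (inj₂ refl) = lo≤hi , ≤-refl
    u∈ : lo ≤ entry p × entry p ≤ hi
    u∈ = inInterval ([ inj₁ ∘ sym ∘ proj₁ , inj₂ ∘ sym ∘ proj₂ ]′ ends)
    v∈ : lo ≤ entry q × entry q ≤ hi
    v∈ = inInterval ([ inj₂ ∘ sym ∘ proj₂ , inj₁ ∘ sym ∘ proj₁ ]′ ends)
    inside : ∀ {k} → k ≢ entry p → k ≢ entry q → k ≢ lo × k ≢ hi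
    inside k≢u k≢v = [ (λ { (refl , refl) → k≢u , k≢v }) , (λ { (refl , refl) → k≢v , k≢u }) ]′ ends
    i≤p : i Fin.≤ p
    i≤p = subst₂ _≤_ (pos-value x refl) (pos-value x refl) (f (proj₁ u∈) (proj₂ u∈))
    q≤j : q Fin.≤ j
    q≤j = subst₂ _≤_ (pos-value x refl) (pos-value x refl) (g (proj₁ v∈) (proj₂ v∈))
    k≢u : entry i ≢ entry p
    k≢u eq = <⇒≱ v<u (subst (λ k → Y._≼_ k (entry q)) eq (fʸ (proj₁ v∈) (proj₂ v∈)))
    m≢v : entry j ≢ entry q
    m≢v eq = <⇒≱ v<u (subst (Y._≼_ (entry p)) eq (gʸ (proj₁ u∈) (proj₂ u∈)))
    k≢v : entry i ≢ entry q
    k≢v eq = <⇒≱ p<q (subst (λ i → i Fin.≤ p) (entry-injective x (toℕ-injective eq)) i≤p)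
    m≢u : entry j ≢ entry p
    m≢u eq = <⇒≱ p<q (subst (q Fin.≤_) (entry-injective x (toℕ-injective eq)) q≤j)

  adjacent-inversion⇒Θ : ∀ {p q} → toℕ q ≡ suc (toℕ p) →
    Y.pos (toℕ (x ⟨$⟩ʳ q)) < Y.pos (toℕ (x ⟨$⟩ʳ p)) → Θ-tB x (transpose p q ∘ₚ x)
  adjacent-inversion⇒Θ {p} {q} p⋖q v<u with ≤-total (toℕ (x ⟨$⟩ʳ p)) (toℕ (x ⟨$⟩ʳ q))
  -- An ascent: `x` arises by a move from the exchanged permutation.
  ... | inj₁ u≤v = straddled⇒Θ p⋖q
          (straddled-swap p⋖q (inversion⇒straddled (≤-reflexive (sym p⋖q)) v<u u≤v (toℕ<n _) (inj₁ (refl , refl))))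
          (λ i → cong (x ⟨$⟩ʳ_) (sym (transpose-involutive p q i)))
  -- A descent: the move leads down from `x` and is read backwards.
  ... | inj₂ v≤u = EqClosure.symmetric _ (straddled⇒Θ p⋖q
          (inversion⇒straddled (≤-reflexive (sym p⋖q)) v<u v≤u (toℕ<n _) (inj₂ (refl , refl)))
          (λ _ → refl))

-- Sorting one permutation into the other

module _ {n} (y : Permutation′ n) where

  AgreeBelow : ℕ → Permutation′ n → Set
  AgreeBelow t x = ∀ i → toℕ i < t → x ⟨$⟩ʳ i ≡ y ⟨$⟩ʳ i

  -- An entry in a position of `y` below `t` has the same position in `x`, by injectivity.
  agree⇒≤ : ∀ {t x} → AgreeBelow t x → ∀ {i j} → x ⟨$⟩ʳ i ≡ y ⟨$⟩ʳ j → t ≤ toℕ i → t ≤ toℕ j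
  agree⇒≤ {x = x} agree {i} {j} eq t≤i = ≮⇒≥ λ j<t →
    <⇒≱ (subst (λ i → toℕ i < _) (entry-injective x (trans (agree j j<t) (sym eq))) j<t) t≤i

  -- x is sorted into y from left to right: sift moves the entry that
  -- belongs in position t down to it from position d + t.
  sort : ∀ f {t x} → f + t ≡ n → AgreeBelow t x → SameOwners x y → Θ-tB x y
  sift : ∀ f d {t} {x : Permutation′ n} (q s : Fin n) → suc f + t ≡ n → toℕ s ≡ t → toℕ q ≡ d + t →
         x ⟨$⟩ʳ q ≡ y ⟨$⟩ʳ s → AgreeBelow t x → SameOwners x y → Θ-tB x y

  -- Here `t` is `n`, so the two permutations agree pointwise and the generator `_≈_` closes the
  -- chain.
  sort zero refl agree same = EqClosure.return (inj₁ λ i → agree i (toℕ<n i))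
  sort (suc f) {t} {x} f+t≡n agree same =
    -- Passing to `sift` lowers `f`, and each exchange lowers `d`; hence the recursion terminates.
    sift f (toℕ q ∸ t) q s f+t≡n s≡t (sym (m∸n+n≡m t≤q)) (inverseʳ x) agree same
    where
    t<n : t < n
    t<n = subst (t <_) f+t≡n (s≤s (m≤n+m t f))
    s = fromℕ< t<n
    s≡t = toℕ-fromℕ< t<n
    q = x ⟨$⟩ˡ (y ⟨$⟩ʳ s)
    t≤q : t ≤ toℕ q
    t≤q = ≮⇒≥ λ q<t → <⇒≢ q<t (trans (cong toℕ (entry-injective y (trans (sym (agree q q<t)) (inverseʳ x)))) s≡t)

  sift f zero {t} {x} q s f+t≡n s≡t q≡t xq≡ys agree same = sort f (trans (+-suc f t) f+t≡n) agree′ same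
    where
    agree′ : AgreeBelow (suc t) x
    agree′ i i≤t with m≤n⇒m<n∨m≡n (s≤s⁻¹ i≤t)
    ... | inj₁ i<t = agree i i<t
    ... | inj₂ i≡t = subst₂ (λ i j → x ⟨$⟩ʳ i ≡ y ⟨$⟩ʳ j)
          (toℕ-injective (trans q≡t (sym i≡t))) (toℕ-injective (trans s≡t (sym i≡t))) xq≡ys
  sift f (suc d) {t} {x} q s f+t≡n s≡t q≡ xq≡ys agree same =
    EqClosure.transitive _ step
      (sift f d p s f+t≡n s≡t p≡ (trans (cong (x ⟨$⟩ʳ_) (transpose-fst p q)) xq≡ys) agree′
        -- The exchange is a move or its inverse and so preserves owners, which restores the
        -- invariant.
        (Same.trans (Same.sym (Θ⇒sameOwners step)) same))
    where
    d+t<n : d + t < n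
    d+t<n = <-trans (subst (d + t <_) (sym q≡) ≤-refl) (toℕ<n q)
    p = fromℕ< d+t<n
    p≡ : toℕ p ≡ d + t
    p≡ = toℕ-fromℕ< d+t<n
    p⋖q : toℕ q ≡ suc (toℕ p)
    p⋖q = trans q≡ (cong suc (sym p≡))
    t≤p : t ≤ toℕ p
    t≤p = subst (t ≤_) (sym p≡) (m≤n+m t d)
    j = y ⟨$⟩ˡ (x ⟨$⟩ʳ p)
    -- The entry at `q` belongs in position `t` of `y` and the entry at `p` in a later one, so the
    -- adjacent pair is inverted relative to `y`.
    t<j : t < toℕ j
    t<j = ≤∧≢⇒< (agree⇒≤ {x = x} agree (sym (inverseʳ y)) t≤p) λ t≡j →
      1+n≢n (trans (sym p⋖q) (cong toℕ (entry-injective x (trans xq≡ys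
        (trans (cong (y ⟨$⟩ʳ_) (toℕ-injective (trans s≡t t≡j))) (inverseʳ y))))))
    step : Θ-tB x (transpose p q ∘ₚ x)
    step = adjacent-inversion⇒Θ same p⋖q
      (subst₂ _<_ (sym (trans (pos-value y (sym xq≡ys)) s≡t)) (sym (pos-value y (inverseʳ y))) t<j)
    agree′ : AgreeBelow t (transpose p q ∘ₚ x)
    agree′ i i<t = trans (cong (x ⟨$⟩ʳ_) (transpose-other p q
      (<⇒≢ (<-≤-trans i<t t≤p) ∘ cong toℕ)
      (<⇒≢ (<-≤-trans i<t (≤-trans t≤p (≤-trans (n≤1+n _) (≤-reflexive (sym p⋖q))))) ∘ cong toℕ))) (agree i i<t)

  sameOwners⇒Θ : ∀ {x} → SameOwners x y → Θ-tB x y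
  sameOwners⇒Θ = sort n (+-identityʳ n) (λ _ ())

proposition6p3 : (n : ℕ) → 1 ≤ n → (x y : Permutation′ n) → (ρ x ≈ᴿ ρ y) ⇔ Θ-tB x y
proposition6p3 n _ x y = mk⇔ ρ⇒Θ Θ⇒ρ
  where
  ρ⇒Θ : ρ x ≈ᴿ ρ y → Θ-tB x y
  ρ⇒Θ eq = sameOwners⇒Θ y (ρ⇒sameOwners eq)
  Θ⇒ρ : Θ-tB x y → ρ x ≈ᴿ ρ y
  Θ⇒ρ θ = sameOwners⇒ρ (Θ⇒sameOwners θ)
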